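{- Let $H$ be a finite graph. The up and right graph $U$ is strongly $H$-induced-saturated if and only if all of the following hold: (1) $H$ is not a permutation graph; (2) there exists an edge $e$ of $H$ such that $H-e$ is a permutation graph; (3) there exists a non-edge $\overline{e}$ of $H$ (a pair of distinct non-adjacent vertices) such that $H+\overline{e}$ is a permutation graph.
   Context: The up and right graph $U$ has vertex set $\mathbb{Q}\times\mathbb{Q}$, and distinct vertices $(q,r)$ and $(s,t)$ are adjacent if and only if either ($q+r\sqrt2<s+t\sqrt2$ and $q-r\sqrt2<s-t\sqrt2$) or ($q+r\sqrt2>s+t\sqrt2$ and $q-r\sqrt2>s-t\sqrt2$). A finite graph on vertices $v_1,\dots,v_n$ is a permutation graph if there is a permutation $\sigma$ of $\{1,\dots,n\}$ such that for all $i<j$, $v_iv_j$ is an edge if and only if $\sigma(i)<\sigma(j)$ (for some labelling of the vertices). Graphs are simple with countable vertex sets; $H$-free means containing no induced copy of $H$. Perturbing a pair of distinct vertices $u,v$ means deleting $uv$ if it is an edge and adding it otherwise; a locally finite perturbation of $G$ is obtained by perturbing a nonempty set of pairs such that each vertex lies in finitely many perturbed pairs. A graph $G$ is strongly $H$-induced-saturated if $G$ is $H$-free but every locally finite perturbation of $G$ contains an induced copy of $H$. -}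

module Defs where

open import Data.Nat using (ℕ)
open import Data.Fin using (Fin; _<_; _≟_)
open import Data.Fin.Permutation using (Permutation; _⟨$⟩ʳ_)
open import Data.Bool using (Bool; true; false; not; if_then_else_; _∧_; _∨_)
open import Data.Rational using (ℚ; 0ℚ; _+_; _-_; _*_; -_; 1ℚ)
import Data.Rational as ℚ
open import Data.Product using (Σ; _×_; ∃; ∃-syntax)
open import Data.Sum using (_⊎_)
open import Data.List using (List)
open import Data.List.Membership.Propositional using (_∈_)
open import Relation.Nullary using (¬_; ⌊_⌋)
open import Relation.Binary.PropositionalEquality using (_≡_; _≢_)
open import Function.Bundles using (_⇔_)

record FinGraph : Set where
  field
    n     : ℕ
    adj   : Fin n → Fin n → Bool
    sym   : ∀ i j → adj i j ≡ adj j i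
    irrefl : ∀ i → adj i i ≡ false
open FinGraph public

IsPermutationGraph : (n : ℕ) → (Fin n → Fin n → Bool) → Set
IsPermutationGraph n a =
  Σ (Permutation n n) λ lab → Σ (Permutation n n) λ σ →
    ∀ (i j : Fin n) → i < j →
      (a (lab ⟨$⟩ʳ i) (lab ⟨$⟩ʳ j) ≡ true) ⇔ ((σ ⟨$⟩ʳ i) < (σ ⟨$⟩ʳ j))

toggle : {n : ℕ} → (Fin n → Fin n → Bool) → Fin n → Fin n → Fin n → Fin n → Bool
toggle a x y u v =
  if (⌊ u ≟ x ⌋ ∧ ⌊ v ≟ y ⌋) ∨ (⌊ u ≟ y ⌋ ∧ ⌊ v ≟ x ⌋) then not (a u v) else a u v

ContainsInduced : {V : Set} → (V → V → Set) → FinGraph → Set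
ContainsInduced {V} G H =
  Σ (Fin (n H) → V) λ f →
    (∀ i j → f i ≡ f j → i ≡ j) ×
    (∀ i j → i ≢ j → (adj H i j ≡ true) ⇔ G (f i) (f j))

Free : {V : Set} → (V → V → Set) → FinGraph → Set
Free G H = ¬ ContainsInduced G H

record LocFinPerturbation (V : Set) : Set₁ where
  field
    P         : V → V → Set
    P-sym     : ∀ u v → P u v → P v u
    P-distinct : ∀ u v → P u v → u ≢ v
    nonempty  : ∃[ u ] ∃[ v ] P u v
    locFinite : ∀ u → Σ (List V) λ L → ∀ v → P u v → v ∈ L
open LocFinPerturbation public

perturb : {V : Set} → (V → V → Set) → LocFinPerturbation V → V → V → Set
perturb G Π u v = (G u v × ¬ P Π u v) ⊎ (¬ G u v × P Π u v)

StronglyInducedSaturated : {V : Set} → (V → V → Set) → FinGraph → Set₁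
StronglyInducedSaturated {V} G H =
  Free G H × (∀ (Π : LocFinPerturbation V) → ContainsInduced (perturb G Π) H)

-- LtSqrt2 a b  encodes the real inequality  a < b·√2  (a, b rational),
-- decided exactly without reals.
LtSqrt2 : ℚ → ℚ → Set
LtSqrt2 a b =
  (0ℚ ℚ.< b × (a ℚ.< 0ℚ ⊎ a * a ℚ.< (1ℚ + 1ℚ) * (b * b)))
  ⊎ (b ℚ.≤ 0ℚ × a ℚ.< 0ℚ × (1ℚ + 1ℚ) * (b * b) ℚ.< a * a)

-- q + r√2 < s + t√2   ⟺   q - s < (t - r)√2
LtPlus : ℚ × ℚ → ℚ × ℚ → Set
LtPlus (q Data.Product., r) (s Data.Product., t) = LtSqrt2 (q - s) (t - r)

-- q - r√2 < s - t√2   ⟺   q - s < (r - t)√2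
LtMinus : ℚ × ℚ → ℚ × ℚ → Set
LtMinus (q Data.Product., r) (s Data.Product., t) = LtSqrt2 (q - s) (r - t)

UAdj : ℚ × ℚ → ℚ × ℚ → Set
UAdj u v = (LtPlus u v × LtMinus u v) ⊎ (LtPlus v u × LtMinus v u)

-- Order ℚ × ℚ by q + r√2 and by q − r√2. Since √2 is irrational both orders are strict and total,
-- and two vertices of U are adjacent iff the two orders agree on them; hence
-- the finite induced subgraphs of U are permutation graphs. Conversely, the two orders are jointly
-- dense: any open interval of the first and any open interval of the second have a common point.
-- So the vertices of a permutation graph can be placed in U one at a time, starting from any
-- consistently placed pair, and each new vertex can moreover avoid a given finite set, in particular
-- the perturbed partners of the vertices placed before. Starting from a perturbed pair and using
-- H ± e, this gives a copy of H in any locally finite perturbation. Conditions (2) and (3) are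
-- necessary because a copy of H in U with a single perturbed pair must use that pair.
{-# OPTIONS --safe #-}
module Submission where

open import Defs hiding (sym)
open import Data.Bool using (Bool; true; false; not)
open import Data.Bool.Properties using (¬-not)
open import Data.Empty using (⊥; ⊥-elim)
open import Data.Fin using (Fin; punchOut; fromℕ<)
open import Data.Fin.Permutation
  using (Permutation; permutation; _⟨$⟩ʳ_; _⟨$⟩ˡ_; inverseˡ; inverseʳ; flip; _∘ₚ_)
import Data.Fin as Fin
import Data.Fin.Properties as Fin
import Data.Fin.Subset as Subset
import Data.Fin.Subset.Properties as Subset
import Data.Integer as ℤ
import Data.Integer.Properties as ℤₚ
open import Data.List using (List; []; _∷_; _++_; map; filter; concatMap; allFin)
open import Data.List.Membership.Propositional using (_∈_; _∉_; lose)
open import Data.List.Membership.Propositional.Properties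
  using (∈-allFin; ∈-map⁺; ∈-map⁻; ∈-filter⁺; ∈-filter⁻; ∈-concatMap⁺)
open import Data.List.Relation.Unary.All using (All; []; _∷_)
import Data.List.Relation.Unary.All as All
import Data.List.Relation.Unary.All.Properties as All
open import Data.List.Relation.Unary.Any using (here; there)
open import Data.Nat using (ℕ; zero; suc)
import Data.Nat as ℕ
open import Data.Nat.Divisibility using (divides)
open import Data.Nat.Induction using (<-rec)
open import Data.Nat.Primality using (prime[2]; euclidsLemma)
import Data.Nat.Properties as ℕₚ
import Data.Nat.Tactic.RingSolver as ℕ-Solver
open import Data.Product using (Σ; _×_; _,_; proj₁; proj₂; ∃-syntax)
import Data.Product as Product
open import Data.Rational
open import Data.Rational.Properties
import Data.Rational.Unnormalised as ℚᵘ
import Data.Rational.Unnormalised.Properties as ℚᵘₚ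
open import Data.Sum using (_⊎_; inj₁; inj₂; [_,_]′; reduce)
import Data.Sum as Sum
open import Data.Vec using (tabulate)
open import Data.Vec.Functional using (updateAt)
open import Data.Vec.Functional.Properties using (updateAt-updates; updateAt-minimal)
open import Data.Vec.Properties using (lookup∘tabulate; lookup⇒[]=; []=⇒lookup)
open import Function using (_∘_)
open import Function.Bundles using (_⇔_; mk⇔; Equivalence)
open import Function.Construct.Composition using (_⇔-∘_)
open import Function.Construct.Symmetry using (⇔-sym)
open import Level using (0ℓ)
open import Relation.Binary using (IsStrictTotalOrder; Trichotomous; Tri; tri<; tri≈; tri>)
open import Relation.Binary.PropositionalEquality
open import Relation.Binary.Structures.Biased using (isStrictTotalOrderᶜ)
open import Relation.Nullary using (¬_; Dec; yes; no; does; contradiction)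
open import Relation.Nullary.Decidable
  using (dec⇒maybe; dec-true; decidable-stable; _×-dec_; _⊎-dec_)
open import Tactic.RingSolver using (solve-∀)
open import Tactic.RingSolver.Core.AlmostCommutativeRing using (AlmostCommutativeRing; fromCommutativeRing)

-- Rational arithmetic

ℚ-ring : AlmostCommutativeRing 0ℓ 0ℓ
ℚ-ring = fromCommutativeRing +-*-commutativeRing λ x → dec⇒maybe (0ℚ ≟ x)

2ℚ : ℚ
2ℚ = 1ℚ + 1ℚ

0<1 : 0ℚ < 1ℚ
0<1 = positive⁻¹ 1ℚ

0<2 : 0ℚ < 2ℚ
0<2 = positive⁻¹ 2ℚ

x+[y-x]≡y : ∀ x y → x + (y - x) ≡ y
x+[y-x]≡y = solve-∀ ℚ-ring

0<½ : 0ℚ < ½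
0<½ = positive⁻¹ ½

<-by : ∀ {x y z} → 0ℚ < z → y - x ≡ z → x < y
<-by {x} {y} 0<z refl =
  subst₂ _<_ (+-identityʳ x) (x+[y-x]≡y x y) (+-monoʳ-< x 0<z)

≤-by : ∀ {x y z} → 0ℚ ≤ z → y - x ≡ z → x ≤ y
≤-by {x} {y} 0≤z refl =
  subst₂ _≤_ (+-identityʳ x) (x+[y-x]≡y x y) (+-monoʳ-≤ x 0≤z)

0<diff : ∀ {x y} → x < y → 0ℚ < y - x
0<diff {x} {y} x<y = subst (_< y - x) (+-inverseʳ x) (+-monoˡ-< (- x) x<y)

0≤diff : ∀ {x y} → x ≤ y → 0ℚ ≤ y - x
0≤diff {x} {y} x≤y = subst (_≤ y - x) (+-inverseʳ x) (+-monoˡ-≤ (- x) x≤y)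

+-pos : ∀ {x y} → 0ℚ < x → 0ℚ < y → 0ℚ < x + y
+-pos = +-mono-<

+-pos-nonNeg : ∀ {x y} → 0ℚ < x → 0ℚ ≤ y → 0ℚ < x + y
+-pos-nonNeg = +-mono-<-≤

+-nonNeg : ∀ {x y} → 0ℚ ≤ x → 0ℚ ≤ y → 0ℚ ≤ x + y
+-nonNeg = +-mono-≤

*-pos : ∀ {x y} → 0ℚ < x → 0ℚ < y → 0ℚ < x * y
*-pos {x} {y} 0<x 0<y =
  positive⁻¹ (x * y) {{pos*pos⇒pos x {{positive 0<x}} y {{positive 0<y}}}}

*-nonNeg : ∀ {x y} → 0ℚ ≤ x → 0ℚ ≤ y → 0ℚ ≤ x * y
*-nonNeg {x} {y} 0≤x 0≤y = nonNegative⁻¹ (x * y)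
  {{nonNeg*nonNeg⇒nonNeg x {{nonNegative 0≤x}} y {{nonNegative 0≤y}}}}

neg⇒0< : ∀ {x} → x < 0ℚ → 0ℚ < - x
neg⇒0< = neg-antimono-<

nonPos⇒0≤ : ∀ {x} → x ≤ 0ℚ → 0ℚ ≤ - x
nonPos⇒0≤ = neg-antimono-≤

*-cancelʳ-< : ∀ x y {z} → 0ℚ < z → x * z < y * z → x < y
*-cancelʳ-< x y {z} 0<z = *-cancelʳ-<-nonNeg z {{nonNegative (<⇒≤ 0<z)}}

-- Division is stated as a multiplicative equation, so that later ring identities involve no inverse
-- and no `NonZero` instance.
quotient : ∀ x y → 0ℚ < y → ∃[ q ] q * y ≡ x
quotient x y 0<y = x * 1/ y , (begin
  x * 1/ y * y    ≡⟨ *-assoc x (1/ y) y ⟩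
  x * (1/ y * y)  ≡⟨ cong (x *_) (*-inverseˡ y) ⟩
  x * 1ℚ          ≡⟨ *-identityʳ x ⟩
  x               ∎)
  where
  open ≡-Reasoning
  instance _ = pos⇒nonZero y {{positive 0<y}}

-- Irrationality of √2

-- Infinite descent on `m`. If m ≤ n, then n² + n² ≤ n². Otherwise m = 2k is even, and the pair (n,
-- k) solves the same equation with n < m.
m²≡2n²⇒n≡0 : ∀ m n → m ℕ.* m ≡ 2 ℕ.* (n ℕ.* n) → n ≡ 0
m²≡2n²⇒n≡0 = <-rec _ descent
  where
  descent : ∀ m → (∀ {k} → k ℕ.< m → ∀ n → k ℕ.* k ≡ 2 ℕ.* (n ℕ.* n) → n ≡ 0) →
            ∀ n → m ℕ.* m ≡ 2 ℕ.* (n ℕ.* n) → n ≡ 0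
  descent m rec n eq with m ℕ.≤? n
  ... | yes m≤n = n≡0
    where
    open ℕₚ.≤-Reasoning
    n²≤0 : n ℕ.* n ℕ.≤ 0
    n²≤0 = ℕₚ.+-cancelˡ-≤ (n ℕ.* n) _ _ (begin
      n ℕ.* n ℕ.+ n ℕ.* n  ≡⟨ cong (n ℕ.* n ℕ.+_) (ℕₚ.+-identityʳ (n ℕ.* n)) ⟨
      2 ℕ.* (n ℕ.* n)      ≡⟨ eq ⟨
      m ℕ.* m              ≤⟨ ℕₚ.*-mono-≤ m≤n m≤n ⟩
      n ℕ.* n              ≡⟨ ℕₚ.+-identityʳ (n ℕ.* n) ⟨
      n ℕ.* n ℕ.+ 0        ∎)
    n≡0 : n ≡ 0
    n≡0 = reduce (ℕₚ.m*n≡0⇒m≡0∨n≡0 n (ℕₚ.n≤0⇒n≡0 n²≤0))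
  ... | no m≰n
    with divides k refl ← reduce (euclidsLemma m m prime[2]
                            (divides (n ℕ.* n) (trans eq (ℕₚ.*-comm 2 (n ℕ.* n)))))
    = n≡0
    where
    4k² : ∀ k → (k ℕ.* 2) ℕ.* (k ℕ.* 2) ≡ 2 ℕ.* (2 ℕ.* (k ℕ.* k))
    4k² = ℕ-Solver.solve-∀
    n²≡2k² : n ℕ.* n ≡ 2 ℕ.* (k ℕ.* k)
    n²≡2k² = ℕₚ.*-cancelˡ-≡ _ _ 2 (trans (sym eq) (4k² k))
    k≡0 : k ≡ 0
    k≡0 = rec (ℕₚ.≰⇒> m≰n) k n²≡2k²
    n≡0 : n ≡ 0
    n≡0 = reduce (ℕₚ.m*n≡0⇒m≡0∨n≡0 n (trans n²≡2k² (cong (λ k → 2 ℕ.* (k ℕ.* k)) k≡0)))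

-- With a = p/d and b = q/e, clearing denominators turns the equation into (|p|e)² = 2(|q|d)² over
-- ℕ, where |q|d is non-zero. Matching on `record{}` exposes these fractions.
a²≢2b² : ∀ a b → 0ℚ < b → a * a ≢ 2ℚ * (b * b)
a²≢2b² a@record{} b@record{} 0<b eq = ℕ.≢-nonZero⁻¹ (∣q∣ ℕ.* d) {{ℕₚ.m*n≢0 ∣q∣ d}} (m²≡2n²⇒n≡0 (∣p∣ ℕ.* e) (∣q∣ ℕ.* d) eqℕ)
  where
  ∣p∣ = ℤ.∣ ↥ a ∣
  ∣q∣ = ℤ.∣ ↥ b ∣
  d = ↧ₙ a
  e = ↧ₙ b
  instance
    b≢0 : ℕ.NonZero ∣q∣
    b≢0 = pos⇒nonZero b {{positive 0<b}}
  eqᵘ : toℚᵘ a ℚᵘ.* toℚᵘ a ℚᵘ.≃ toℚᵘ 2ℚ ℚᵘ.* (toℚᵘ b ℚᵘ.* toℚᵘ b)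
  eqᵘ = begin
    toℚᵘ a ℚᵘ.* toℚᵘ a                  ≈⟨ toℚᵘ-homo-* a a ⟨
    toℚᵘ (a * a)                        ≡⟨ cong toℚᵘ eq ⟩
    toℚᵘ (2ℚ * (b * b))                 ≈⟨ toℚᵘ-homo-* 2ℚ (b * b) ⟩
    toℚᵘ 2ℚ ℚᵘ.* toℚᵘ (b * b)           ≈⟨ ℚᵘₚ.*-congˡ {toℚᵘ 2ℚ} (toℚᵘ-homo-* b b) ⟩
    toℚᵘ 2ℚ ℚᵘ.* (toℚᵘ b ℚᵘ.* toℚᵘ b)   ∎
    where open ℚᵘₚ.≃-Reasoning
  eqℤ : (↥ a ℤ.* ↥ a) ℤ.* ℤ.+ (1 ℕ.* (e ℕ.* e)) ≡ (ℤ.+ 2 ℤ.* (↥ b ℤ.* ↥ b)) ℤ.* ℤ.+ (d ℕ.* d)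
  eqℤ with ℚᵘ.*≡* r ← eqᵘ = r
  eqℕ : (∣p∣ ℕ.* e) ℕ.* (∣p∣ ℕ.* e) ≡ 2 ℕ.* ((∣q∣ ℕ.* d) ℕ.* (∣q∣ ℕ.* d))
  eqℕ = begin
    (∣p∣ ℕ.* e) ℕ.* (∣p∣ ℕ.* e)                          ≡⟨ lemˡ ∣p∣ e ⟩
    (∣p∣ ℕ.* ∣p∣) ℕ.* (1 ℕ.* (e ℕ.* e))                  ≡⟨ cong (ℕ._* (1 ℕ.* (e ℕ.* e))) (ℤₚ.abs-* (↥ a) (↥ a)) ⟨
    ℤ.∣ ↥ a ℤ.* ↥ a ∣ ℕ.* (1 ℕ.* (e ℕ.* e))              ≡⟨ ℤₚ.abs-* (↥ a ℤ.* ↥ a) _ ⟨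
    ℤ.∣ (↥ a ℤ.* ↥ a) ℤ.* ℤ.+ (1 ℕ.* (e ℕ.* e)) ∣        ≡⟨ cong ℤ.∣_∣ eqℤ ⟩
    ℤ.∣ (ℤ.+ 2 ℤ.* (↥ b ℤ.* ↥ b)) ℤ.* ℤ.+ (d ℕ.* d) ∣    ≡⟨ ℤₚ.abs-* (ℤ.+ 2 ℤ.* (↥ b ℤ.* ↥ b)) _ ⟩
    ℤ.∣ ℤ.+ 2 ℤ.* (↥ b ℤ.* ↥ b) ∣ ℕ.* (d ℕ.* d)          ≡⟨ cong (ℕ._* (d ℕ.* d)) (ℤₚ.abs-* (ℤ.+ 2) (↥ b ℤ.* ↥ b)) ⟩
    2 ℕ.* ℤ.∣ ↥ b ℤ.* ↥ b ∣ ℕ.* (d ℕ.* d)                ≡⟨ cong (λ k → 2 ℕ.* k ℕ.* (d ℕ.* d)) (ℤₚ.abs-* (↥ b) (↥ b)) ⟩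
    2 ℕ.* (∣q∣ ℕ.* ∣q∣) ℕ.* (d ℕ.* d)                    ≡⟨ lemʳ ∣q∣ d ⟩
    2 ℕ.* ((∣q∣ ℕ.* d) ℕ.* (∣q∣ ℕ.* d))                  ∎
    where
    open ≡-Reasoning
    lemˡ : ∀ x y → (x ℕ.* y) ℕ.* (x ℕ.* y) ≡ (x ℕ.* x) ℕ.* (1 ℕ.* (y ℕ.* y))
    lemˡ = ℕ-Solver.solve-∀
    lemʳ : ∀ x y → 2 ℕ.* (x ℕ.* x) ℕ.* (y ℕ.* y) ≡ 2 ℕ.* ((x ℕ.* y) ℕ.* (x ℕ.* y))
    lemʳ = ℕ-Solver.solve-∀

-- The Archimedean property

-- Recursion makes `ι (suc n)` unfold to `1ℚ + ι n`, the form in which the ring solver meets it.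
ι : ℕ → ℚ
ι zero    = 0ℚ
ι (suc n) = 1ℚ + ι n

ι-nonNeg : ∀ n → 0ℚ ≤ ι n
ι-nonNeg zero    = ≤-refl
ι-nonNeg (suc n) = +-nonNeg (<⇒≤ 0<1) (ι-nonNeg n)

toℚᵘ-ι : ∀ n → toℚᵘ (ι n) ℚᵘ.≃ ℚᵘ.mkℚᵘ (ℤ.+ n) 0
toℚᵘ-ι zero    = ℚᵘ.*≡* refl
toℚᵘ-ι (suc n) = begin
  toℚᵘ (1ℚ + ι n)                     ≈⟨ toℚᵘ-homo-+ 1ℚ (ι n) ⟩
  ℚᵘ.1ℚᵘ ℚᵘ.+ toℚᵘ (ι n)              ≈⟨ ℚᵘₚ.+-congʳ ℚᵘ.1ℚᵘ (toℚᵘ-ι n) ⟩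
  ℚᵘ.1ℚᵘ ℚᵘ.+ ℚᵘ.mkℚᵘ (ℤ.+ n) 0       ≈⟨ ℚᵘ.*≡* (cong (ℤ._* ℤ.+ 1) (cong (λ i → ℤ.+ 1 ℤ.+ i) (ℤₚ.*-identityʳ (ℤ.+ n)))) ⟩
  ℚᵘ.mkℚᵘ (ℤ.+ suc n) 0               ∎
  where open ℚᵘₚ.≃-Reasoning

-- A denominator is at least 1, so a rational is at most the absolute value of its numerator.
≤ι : ∀ q → q ≤ ι ℤ.∣ ↥ q ∣
≤ι q@record{} = toℚᵘ-cancel-≤ (ℚᵘₚ.≤-trans (ℚᵘ.*≤* num≤) (ℚᵘₚ.≤-reflexive (ℚᵘₚ.≃-sym (toℚᵘ-ι ℤ.∣ ↥ q ∣))))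
  where
  num≤ : ↥ q ℤ.* ℤ.+ 1 ℤ.≤ ℤ.+ ℤ.∣ ↥ q ∣ ℤ.* ↧ q
  num≤ = begin
    ↥ q ℤ.* ℤ.+ 1                    ≡⟨ ℤₚ.*-identityʳ (↥ q) ⟩
    ↥ q                              ≤⟨ i≤∣i∣ (↥ q) ⟩
    ℤ.+ ℤ.∣ ↥ q ∣                    ≤⟨ ℤ.+≤+ (ℕₚ.m≤m*n ℤ.∣ ↥ q ∣ (↧ₙ q)) ⟩
    ℤ.+ (ℤ.∣ ↥ q ∣ ℕ.* ↧ₙ q)         ≡⟨ ℤₚ.pos-* ℤ.∣ ↥ q ∣ (↧ₙ q) ⟩
    ℤ.+ ℤ.∣ ↥ q ∣ ℤ.* ↧ q            ∎
    where
    open ℤₚ.≤-Reasoning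
    i≤∣i∣ : ∀ i → i ℤ.≤ ℤ.+ ℤ.∣ i ∣
    i≤∣i∣ (ℤ.+ n)      = ℤₚ.≤-refl
    i≤∣i∣ ℤ.-[1+ n ]   = ℤ.-≤+

-- Rational neighbourhoods of √2

-- The positive rationals on either side of √2, told apart by their squares.
Lower Upper : ℚ → Set
Lower l = 0ℚ < l × l * l < 2ℚ
Upper h = 0ℚ < h × 2ℚ < h * h

record Bracket : Set where
  constructor bracket
  field
    {lo hi} : ℚ
    lower   : Lower lo
    upper   : Upper hi

open Bracket

infix 4 _∈ᵇ_ _⊆ᵇ_

-- Closed intervals make the rational endpoints available as sample points and as places where a
-- linear function attains its minimum.
_∈ᵇ_ : ℚ → Bracket → Set
c ∈ᵇ B = lo B ≤ c × c ≤ hi B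

_⊆ᵇ_ : Bracket → Bracket → Set
B ⊆ᵇ C = ∀ c → c ∈ᵇ B → c ∈ᵇ C

-- From h² - l² > 0 the positive factor h + l is cancelled.
0<w : ∀ {l h} → Lower l → Upper h → 0ℚ < h - l
0<w {l} {h} (0<l , l²<2) (0<h , 2<h²) =
  0<diff (*-cancelʳ-< l h (+-pos 0<h 0<l) (<-by
    (+-pos (0<diff l²<2) (0<diff 2<h²)) (ring l h)))
  where
  ring : ∀ l h → h * (h + l) - l * (h + l) ≡ 2ℚ - l * l + (h * h - 2ℚ)
  ring = solve-∀ ℚ-ring

lo<hi : ∀ B → lo B < hi B
lo<hi B = <-by (0<w (lower B) (upper B)) refl

max-lower : ∀ {l m} → Lower l → Lower m → ∃[ k ] Lower k × l ≤ k × m ≤ k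
max-lower {l} {m} L M with ≤-total l m
... | inj₁ l≤m = m , M , l≤m , ≤-refl
... | inj₂ m≤l = l , L , ≤-refl , m≤l

min-upper : ∀ {h k} → Upper h → Upper k → ∃[ m ] Upper m × m ≤ h × m ≤ k
min-upper {h} {k} H K with ≤-total h k
... | inj₁ h≤k = h , H , ≤-refl , h≤k
... | inj₂ k≤h = k , K , k≤h , ≤-refl

intersect : ∀ B C → ∃[ D ] D ⊆ᵇ B × D ⊆ᵇ C
intersect B C
  with max-lower (lower B) (lower C) | min-upper (upper B) (upper C)
... | l , L , B≤l , C≤l | h , H , h≤B , h≤C =
  bracket L H ,
  (λ c (l≤c , c≤h) → ≤-trans B≤l l≤c , ≤-trans c≤h h≤B) ,
  (λ c (l≤c , c≤h) → ≤-trans C≤l l≤c , ≤-trans c≤h h≤C)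

1-lower : Lower 1ℚ
1-lower = 0<1 , <-by 0<1 refl

2-upper : Upper 2ℚ
2-upper = 0<2 , <-by 0<2 refl

[1,2] : Bracket
[1,2] = bracket 1-lower 2-upper

compare-√2 : ∀ c → 0ℚ < c → Lower c ⊎ Upper c
compare-√2 c 0<c with <-cmp (c * c) 2ℚ
... | tri< c²<2 _ _ = inj₁ (0<c , c²<2)
... | tri≈ _ c²≡2 _ = ⊥-elim (a²≢2b² c 1ℚ 0<1 c²≡2)
... | tri> _ _ c²>2 = inj₂ (0<c , c²>2)

-- Each step halves the width, and (n + 2)/2 ≤ n + 1, so the bound 1/(n + 1) persists. It is weaker
-- than 2⁻ⁿ but combines directly with `≤ι`.
bisect : ∀ n → ∃[ B ] B ⊆ᵇ [1,2] × (hi B - lo B) * ι (suc n) ≤ 1ℚ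
bisect zero = [1,2] , (λ c c∈ → c∈) , ≤-refl
bisect (suc n) with bisect n
... | B , B⊆ , w≤ = halve (compare-√2 c (*-pos (+-pos (proj₁ (lower B)) (proj₁ (upper B))) 0<½))
  where
  l h c : ℚ
  l = lo B
  h = hi B
  c = (l + h) * ½
  0≤w½ : 0ℚ ≤ (h - l) * ½
  0≤w½ = *-nonNeg (<⇒≤ (0<w (lower B) (upper B))) (<⇒≤ 0<½)
  mid-l : ∀ l h → (l + h) * ½ - l ≡ (h - l) * ½
  mid-l = solve-∀ ℚ-ring
  h-mid : ∀ l h → h - (l + h) * ½ ≡ (h - l) * ½
  h-mid = solve-∀ ℚ-ring
  l≤c : l ≤ c
  l≤c = ≤-by 0≤w½ (mid-l l h)
  c≤h : c ≤ h
  c≤h = ≤-by 0≤w½ (h-mid l h)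
  half-narrow : ∀ w → w ≡ (h - l) * ½ → w * ι (suc (suc n)) ≤ 1ℚ
  half-narrow w refl = ≤-trans (≤-by (*-nonNeg 0≤w½ (ι-nonNeg n)) (ring (h - l) (ι n))) w≤
    where
    ring : ∀ w x → w * (1ℚ + x) - w * ½ * (1ℚ + (1ℚ + x)) ≡ w * ½ * x
    ring = solve-∀ ℚ-ring
  halve : Lower c ⊎ Upper c → _
  halve (inj₁ L) = bracket L (upper B) ,
    (λ d (c≤d , d≤h) → B⊆ d (≤-trans l≤c c≤d , d≤h)) , half-narrow (h - c) (h-mid l h)
  halve (inj₂ H) = bracket (lower B) H ,
    (λ d (l≤d , d≤c) → B⊆ d (l≤d , ≤-trans d≤c c≤h)) , half-narrow (c - l) (mid-l l h)

-- With q = M/m and a natural number k ≥ q, a width of at most 1/(k + 1) gives M · width ≤ mq/(k +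
-- 1) < m. Intersecting with `B` can only shrink the width.
narrow : ∀ B {M m} → 0ℚ ≤ M → 0ℚ < m →
         ∃[ C ] C ⊆ᵇ B × C ⊆ᵇ [1,2] × M * (hi C - lo C) < m
narrow B {M} {m} 0≤M 0<m
  with q , qm≡M ← quotient M m 0<m
  with D , D⊆[1,2] , w≤ ← bisect ℤ.∣ ↥ q ∣
  with C , C⊆B , C⊆D ← intersect B D
  = C , C⊆B , (λ c c∈ → D⊆[1,2] c (C⊆D c c∈)) , ≤-<-trans Mw≤ M∣D∣<m
  where
  k = ℤ.∣ ↥ q ∣
  w : Bracket → ℚ
  w E = hi E - lo E
  Mw≤ : M * w C ≤ M * w D
  Mw≤ = *-monoˡ-≤-nonNeg M {{nonNegative 0≤M}}
    (+-mono-≤ (proj₂ (C⊆D (hi C) (<⇒≤ (lo<hi C) , ≤-refl)))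
              (neg-antimono-≤ (proj₁ (C⊆D (lo C) (≤-refl , <⇒≤ (lo<hi C))))))
  M∣D∣<m : M * w D < m
  M∣D∣<m = subst (λ M → M * w D < m) qm≡M (<-by
    (+-pos-nonNeg (*-pos (*-pos 0<m (0<w (lower D) (upper D))) 0<1+n-q)
      (*-nonNeg (<⇒≤ 0<m) (0≤diff w≤)))
    (ring m (w D) q (ι k)))
    where
    0<1+n-q : 0ℚ < 1ℚ + (ι k - q)
    0<1+n-q = +-pos-nonNeg 0<1 (0≤diff (≤ι q))
    ring : ∀ m w q x → m - q * m * w ≡ m * w * (1ℚ + (x - q)) + m * (1ℚ - w * (1ℚ + x))
    ring = solve-∀ ℚ-ring

-- Near φ says that φ holds for all rationals in a neighbourhood of √2.
Near : (ℚ → Set) → Set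
Near φ = Σ Bracket λ B → ∀ c → c ∈ᵇ B → φ c

Near-map₂ : ∀ {φ ψ χ : ℚ → Set} → (∀ c → φ c → ψ c → χ c) → Near φ → Near ψ → Near χ
Near-map₂ f (B , φB) (C , ψC) with intersect B C
... | D , D⊆B , D⊆C = D , λ c c∈ → f c (φB c (D⊆B c c∈)) (ψC c (D⊆C c c∈))

Near-∃ : ∀ {φ : ℚ → Set} → Near φ → ∃[ c ] φ c
Near-∃ (B , φB) = lo B , φB (lo B) (≤-refl , <⇒≤ (lo<hi B))

-- From t = a/b, the Newton-like iterate (2t + 2)/(t + 2) lies strictly between t and √2.
LtSqrt2⇒Near : ∀ {a b} → LtSqrt2 a b → Near (λ c → a < b * c)
LtSqrt2⇒Near {a} {b} (inj₁ (0<b , inj₁ a<0)) =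
  [1,2] , λ c (1≤c , _) → <-trans a<0 (*-pos 0<b (<-≤-trans 0<1 1≤c))
LtSqrt2⇒Near {a} {b} (inj₁ (0<b , inj₂ a²<2b²)) with a <? 0ℚ
... | yes a<0 = LtSqrt2⇒Near (inj₁ (0<b , inj₁ a<0))
... | no a≮0 = go (quotient N D 0<D)
  where
  -- `N` + `D`√2 = (2 + √2)(a + b√2), and 2 + √2 has norm 2; so N² - 2D² = 2(a² - 2b²) keeps its
  -- sign.
  N D : ℚ
  N = 2ℚ * (a + b)
  D = a + 2ℚ * b
  0≤a : 0ℚ ≤ a
  0≤a = ≮⇒≥ a≮0
  0<D : 0ℚ < D
  0<D = subst (0ℚ <_) (+-comm (2ℚ * b) a) (+-pos-nonNeg (*-pos 0<2 0<b) 0≤a)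
  0<N : 0ℚ < N
  0<N = *-pos 0<2 (subst (0ℚ <_) (+-comm b a) (+-pos-nonNeg 0<b 0≤a))
  0<Δ : 0ℚ < 2ℚ * (b * b) - a * a
  0<Δ = 0<diff a²<2b²
  go : ∃[ l ] l * D ≡ N → Near (λ c → a < b * c)
  go (l , lD≡N) = bracket (0<l , l²<2) 2-upper , λ c (l≤c , _) →
      <-≤-trans a<bl (*-monoˡ-≤-nonNeg b {{nonNegative (<⇒≤ 0<b)}} l≤c)
    where
    0<l : 0ℚ < l
    0<l = *-cancelʳ-< 0ℚ l 0<D (subst₂ _<_ (sym (*-zeroˡ D)) (sym lD≡N) 0<N)
    l²<2 : l * l < 2ℚ
    l²<2 = *-cancelʳ-< (l * l) 2ℚ (*-pos 0<D 0<D) (<-by (*-pos 0<2 0<Δ) (begin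
      2ℚ * (D * D) - l * l * (D * D)      ≡⟨ r₁ l D ⟩
      2ℚ * (D * D) - (l * D) * (l * D)    ≡⟨ cong (λ x → 2ℚ * (D * D) - x * x) lD≡N ⟩
      2ℚ * (D * D) - N * N                ≡⟨ r₂ a b ⟩
      2ℚ * (2ℚ * (b * b) - a * a)         ∎))
      where
      open ≡-Reasoning
      r₁ : ∀ l D → 2ℚ * (D * D) - l * l * (D * D) ≡ 2ℚ * (D * D) - (l * D) * (l * D)
      r₁ = solve-∀ ℚ-ring
      r₂ : ∀ a b → 2ℚ * ((a + 2ℚ * b) * (a + 2ℚ * b)) - (2ℚ * (a + b)) * (2ℚ * (a + b))
                 ≡ 2ℚ * (2ℚ * (b * b) - a * a)
      r₂ = solve-∀ ℚ-ring
    a<bl : a < b * l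
    a<bl = *-cancelʳ-< a (b * l) 0<D (<-by 0<Δ (begin
      b * l * D - a * D      ≡⟨ cong (_- a * D) (trans (*-assoc b l D) (cong (b *_) lD≡N)) ⟩
      b * N - a * D          ≡⟨ r a b ⟩
      2ℚ * (b * b) - a * a   ∎))
      where
      open ≡-Reasoning
      r : ∀ a b → b * (2ℚ * (a + b)) - a * (a + 2ℚ * b) ≡ 2ℚ * (b * b) - a * a
      r = solve-∀ ℚ-ring
-- Now t = a/b exceeds √2, or is infinite if b = 0, when the cleared form of the iterate still makes
-- sense and gives 2. The iterate is an upper bound of √2, as suits a factor b ≤ 0.
LtSqrt2⇒Near {a} {b} (inj₂ (b≤0 , a<0 , 2b²<a²)) = go (quotient N D 0<D)
  where
  N D : ℚ
  N = 2ℚ * (- a - b)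
  D = - a - 2ℚ * b
  0<D : 0ℚ < D
  0<D = subst (0ℚ <_) (r a b) (+-pos-nonNeg (neg⇒0< a<0) (*-nonNeg (<⇒≤ 0<2) (nonPos⇒0≤ b≤0)))
    where
    r : ∀ a b → - a + 2ℚ * - b ≡ - a - 2ℚ * b
    r = solve-∀ ℚ-ring
  0<N : 0ℚ < N
  0<N = *-pos 0<2 (+-pos-nonNeg (neg⇒0< a<0) (nonPos⇒0≤ b≤0))
  0<Δ : 0ℚ < a * a - 2ℚ * (b * b)
  0<Δ = 0<diff 2b²<a²
  go : ∃[ h ] h * D ≡ N → Near (λ c → a < b * c)
  go (h , hD≡N) = bracket 1-lower (0<h , 2<h²) , λ c (_ , c≤h) →
      <-≤-trans a<bh (*-monoˡ-≤-nonPos b {{nonPositive b≤0}} c≤h)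
    where
    0<h : 0ℚ < h
    0<h = *-cancelʳ-< 0ℚ h 0<D (subst₂ _<_ (sym (*-zeroˡ D)) (sym hD≡N) 0<N)
    2<h² : 2ℚ < h * h
    2<h² = *-cancelʳ-< 2ℚ (h * h) (*-pos 0<D 0<D) (<-by (*-pos 0<2 0<Δ) (begin
      h * h * (D * D) - 2ℚ * (D * D)      ≡⟨ r₁ h D ⟩
      (h * D) * (h * D) - 2ℚ * (D * D)    ≡⟨ cong (λ x → x * x - 2ℚ * (D * D)) hD≡N ⟩
      N * N - 2ℚ * (D * D)                ≡⟨ r₂ a b ⟩
      2ℚ * (a * a - 2ℚ * (b * b))         ∎))
      where
      open ≡-Reasoning
      r₁ : ∀ h D → h * h * (D * D) - 2ℚ * (D * D) ≡ (h * D) * (h * D) - 2ℚ * (D * D)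
      r₁ = solve-∀ ℚ-ring
      r₂ : ∀ a b → (2ℚ * (- a - b)) * (2ℚ * (- a - b)) - 2ℚ * ((- a - 2ℚ * b) * (- a - 2ℚ * b))
                 ≡ 2ℚ * (a * a - 2ℚ * (b * b))
      r₂ = solve-∀ ℚ-ring
    a<bh : a < b * h
    a<bh = *-cancelʳ-< a (b * h) 0<D (<-by 0<Δ (begin
      b * h * D - a * D      ≡⟨ cong (_- a * D) (trans (*-assoc b h D) (cong (b *_) hD≡N)) ⟩
      b * N - a * D          ≡⟨ r a b ⟩
      a * a - 2ℚ * (b * b)   ∎))
      where
      open ≡-Reasoning
      r : ∀ a b → b * (2ℚ * (- a - b)) - a * (- a - 2ℚ * b) ≡ a * a - 2ℚ * (b * b)
      r = solve-∀ ℚ-ring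

-- Totality and additivity of the comparison with multiples of √2

-- For b > 0 either the sign of `a` or the comparison of a² with 2b² decides; equality of the
-- squares is excluded by irrationality.
LtSqrt2-cmp-pos : ∀ a b → 0ℚ < b → LtSqrt2 a b ⊎ LtSqrt2 (- a) (- b)
LtSqrt2-cmp-pos a b 0<b with <-cmp a 0ℚ | <-cmp (a * a) (2ℚ * (b * b))
... | tri< a<0 _ _ | _                 = inj₁ (inj₁ (0<b , inj₁ a<0))
... | _            | tri< a²<2b² _ _   = inj₁ (inj₁ (0<b , inj₂ a²<2b²))
... | _            | tri≈ _ a²≡2b² _   = ⊥-elim (a²≢2b² a b 0<b a²≡2b²)
... | tri≈ _ refl _ | tri> _ _ 2b²<0   = ⊥-elim (<-asym 2b²<0 (*-pos 0<2 (*-pos 0<b 0<b)))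
... | tri> _ _ 0<a | tri> _ _ 2b²<a²   = inj₂ (inj₂ (<⇒≤ (neg-antimono-< 0<b) , neg-antimono-< 0<a ,
        subst₂ _<_ (r₂ b) (r₁ a) 2b²<a²))
  where
  r₁ : ∀ a → a * a ≡ - a * - a
  r₁ = solve-∀ ℚ-ring
  r₂ : ∀ b → 2ℚ * (b * b) ≡ 2ℚ * (- b * - b)
  r₂ = solve-∀ ℚ-ring

neg-invol : ∀ x → - - x ≡ x
neg-invol = solve-∀ ℚ-ring

-- Negating both arguments reduces b < 0 to b > 0; for b = 0 the sign of `a` decides.
LtSqrt2-cmp : ∀ a b → LtSqrt2 a b ⊎ LtSqrt2 (- a) (- b) ⊎ (a ≡ 0ℚ × b ≡ 0ℚ)
LtSqrt2-cmp a b with <-cmp b 0ℚ | <-cmp a 0ℚ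
... | tri> _ _ 0<b | _ = Sum.map₂ inj₁ (LtSqrt2-cmp-pos a b 0<b)
... | tri< b<0 _ _ | _ with LtSqrt2-cmp-pos (- a) (- b) (neg⇒0< b<0)
...   | inj₁ lt = inj₂ (inj₁ lt)
...   | inj₂ gt = inj₁ (subst₂ LtSqrt2 (neg-invol a) (neg-invol b) gt)
LtSqrt2-cmp a b | tri≈ _ refl _ | tri< a<0 _ _ =
  inj₁ (inj₂ (≤-refl , a<0 , subst (0ℚ <_) (r a) (*-pos (neg⇒0< a<0) (neg⇒0< a<0))))
  where
  r : ∀ a → - a * - a ≡ a * a
  r = solve-∀ ℚ-ring
LtSqrt2-cmp a b | tri≈ _ refl _ | tri≈ _ a≡0 _ = inj₂ (inj₂ (a≡0 , refl))
LtSqrt2-cmp a b | tri≈ _ refl _ | tri> _ _ 0<a =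
  inj₂ (inj₁ (inj₂ (≤-refl , neg-antimono-< 0<a , subst (0ℚ <_) (r a) (*-pos 0<a 0<a))))
  where
  r : ∀ a → a * a ≡ - a * - a
  r = solve-∀ ℚ-ring

LtSqrt2-irrefl : ¬ LtSqrt2 0ℚ 0ℚ
LtSqrt2-irrefl (inj₁ (0<0 , _))     = <-irrefl refl 0<0
LtSqrt2-irrefl (inj₂ (_ , 0<0 , _)) = <-irrefl refl 0<0

-- At a fixed rational near √2 both inequalities are linear and can be added, which avoids a case
-- analysis on signs and squares.
LtSqrt2-+ : ∀ {a b c d} → LtSqrt2 a b → LtSqrt2 c d → Near (λ x → a + c < (b + d) * x)
LtSqrt2-+ {a} {b} {c} {d} a<b c<d = Near-map₂
  (λ x a<bx c<dx → subst (a + c <_) (sym (*-distribʳ-+ x b d)) (+-mono-< a<bx c<dx))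
  (LtSqrt2⇒Near {a} {b} a<b) (LtSqrt2⇒Near {c} {d} c<d)

-- By totality only the opposite inequality and the zero case remain to be excluded, and each is
-- refuted at a rational sample point near √2.
Near⇒LtSqrt2 : ∀ {a b} → Near (λ c → a < b * c) → LtSqrt2 a b
Near⇒LtSqrt2 {a} {b} near = decide (LtSqrt2-cmp a b)
  where
  r : ∀ a b x → a - a ≡ b * x + - b * x
  r = solve-∀ ℚ-ring
  decide : LtSqrt2 a b ⊎ LtSqrt2 (- a) (- b) ⊎ (a ≡ 0ℚ × b ≡ 0ℚ) → LtSqrt2 a b
  decide (inj₁ lt) = lt
  decide (inj₂ (inj₁ gt)) =
    let x , lt , gt = Near-∃ (Near-map₂ (λ _ → _,_) near (LtSqrt2⇒Near { - a} { - b} gt))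
    in ⊥-elim (<-irrefl (r a b x) (+-mono-< lt gt))
  decide (inj₂ (inj₂ (refl , refl))) =
    let x , 0<0x = Near-∃ near in ⊥-elim (<-irrefl (sym (*-zeroˡ x)) 0<0x)

-- Joint density of the two orders

-- A linear function of `c` attains its minimum on a closed interval at an endpoint, chosen here by
-- the sign of `b`; that minimum is positive.
margin : ∀ {a b} → LtSqrt2 a b → ∃[ m ] 0ℚ < m × Near (λ c → m ≤ b * c - a)
margin {a} {b} lt = endpoint (LtSqrt2⇒Near lt) (≤-total 0ℚ b)
  where
  endpoint : Near (λ c → a < b * c) → 0ℚ ≤ b ⊎ b ≤ 0ℚ → ∃[ m ] 0ℚ < m × Near (λ c → m ≤ b * c - a)
  endpoint (B , gap) (inj₁ 0≤b) = b * lo B - a , 0<diff (gap (lo B) (≤-refl , <⇒≤ (lo<hi B))) ,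
    B , λ c (l≤c , _) → +-monoˡ-≤ (- a) (*-monoˡ-≤-nonNeg b {{nonNegative 0≤b}} l≤c)
  endpoint (B , gap) (inj₂ b≤0) = b * hi B - a , 0<diff (gap (hi B) (<⇒≤ (lo<hi B) , ≤-refl)) ,
    B , λ c (_ , c≤h) → +-monoˡ-≤ (- a) (*-monoˡ-≤-nonPos b {{nonPositive b≤0}} c≤h)

common-margin : ∀ {a b c d} → LtSqrt2 a b → LtSqrt2 c d →
                ∃[ m ] 0ℚ < m × Near (λ x → m ≤ b * x - a × m ≤ d * x - c)
common-margin {a} {b} {c} {d} lt lt′ = smaller (margin {a} {b} lt) (margin {c} {d} lt′)
  where
  smaller : ∃[ m ] 0ℚ < m × Near (λ x → m ≤ b * x - a) → ∃[ n ] 0ℚ < n × Near (λ x → n ≤ d * x - c) →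
            ∃[ m ] 0ℚ < m × Near (λ x → m ≤ b * x - a × m ≤ d * x - c)
  smaller (m , 0<m , near) (n , 0<n , near′) with ≤-total m n
  ... | inj₁ m≤n = m , 0<m , Near-map₂ (λ _ gap gap′ → gap , ≤-trans m≤n gap′) near near′
  ... | inj₂ n≤m = n , 0<n , Near-map₂ (λ _ gap gap′ → ≤-trans n≤m gap , gap′) near near′

∣x∣≤w : ∀ x w → 0ℚ ≤ w - x → 0ℚ ≤ w + x → ∣ x ∣ ≤ w
∣x∣≤w x w 0≤w-x 0≤w+x with ∣p∣≡p∨∣p∣≡-p x
... | inj₁ eq rewrite eq = ≤-by 0≤w-x refl
... | inj₂ eq rewrite eq = ≤-by 0≤w+x (cong (w +_) (neg-invol x))

∣x∣<m : ∀ x m → ∣ x ∣ < m → 0ℚ < m + x × 0ℚ < m - x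
∣x∣<m x m ∣x∣<m with ≤-total 0ℚ x
... | inj₁ 0≤x = +-pos-nonNeg (≤-<-trans (0≤∣p∣ x) ∣x∣<m) 0≤x ,
                 0<diff (subst (_< m) (0≤p⇒∣p∣≡p 0≤x) ∣x∣<m)
... | inj₂ x≤0 = subst (λ y → 0ℚ < m + y) (neg-invol x)
                   (0<diff (subst (_< m) (trans (sym (∣-p∣≡∣p∣ x)) (0≤p⇒∣p∣≡p 0≤-x)) ∣x∣<m)) ,
                 +-pos-nonNeg (≤-<-trans (0≤∣p∣ x) ∣x∣<m) 0≤-x
  where
  0≤-x : 0ℚ ≤ - x
  0≤-x = nonPos⇒0≤ x≤0

∣as+bt∣≤ : ∀ a b s t {w} → ∣ s ∣ ≤ w → ∣ t ∣ ≤ w → ∣ a * s + b * t ∣ ≤ (∣ a ∣ + ∣ b ∣) * w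
∣as+bt∣≤ a b s t {w} ∣s∣≤w ∣t∣≤w = begin
  ∣ a * s + b * t ∣          ≤⟨ ∣p+q∣≤∣p∣+∣q∣ (a * s) (b * t) ⟩
  ∣ a * s ∣ + ∣ b * t ∣      ≡⟨ cong₂ _+_ (∣p*q∣≡∣p∣*∣q∣ a s) (∣p*q∣≡∣p∣*∣q∣ b t) ⟩
  ∣ a ∣ * ∣ s ∣ + ∣ b ∣ * ∣ t ∣
    ≤⟨ +-mono-≤ (*-monoˡ-≤-nonNeg ∣ a ∣ {{∣-∣-nonNeg a}} ∣s∣≤w) (*-monoˡ-≤-nonNeg ∣ b ∣ {{∣-∣-nonNeg b}} ∣t∣≤w) ⟩
  ∣ a ∣ * w + ∣ b ∣ * w      ≡⟨ *-distribʳ-+ w ∣ a ∣ ∣ b ∣ ⟨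
  (∣ a ∣ + ∣ b ∣) * w        ∎
  where open ≤-Reasoning

¼ : ℚ
¼ = ½ * ½

0<¼ : 0ℚ < ¼
0<¼ = positive⁻¹ ¼

module _ (C : Bracket) (C⊆[1,2] : C ⊆ᵇ [1,2]) where
  private
    l = lo C
    h = hi C

    0≤2-l : 0ℚ ≤ 2ℚ - l
    0≤2-l = 0≤diff (proj₂ (C⊆[1,2] l (≤-refl , <⇒≤ (lo<hi C))))

    0≤2-h : 0ℚ ≤ 2ℚ - h
    0≤2-h = 0≤diff (proj₂ (C⊆[1,2] h (<⇒≤ (lo<hi C) , ≤-refl)))

    0≤l : 0ℚ ≤ l
    0≤l = <⇒≤ (proj₁ (lower C))

    0≤h-l : 0ℚ ≤ h - l
    0≤h-l = <⇒≤ (0<diff (lo<hi C))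

  -- Both ld and 2 lie between l² and h², whose distance (h - l)(h + l) is at most 4(h - l) inside
  -- [1, 2].
  ∣ld-2∣/4≤ : ∀ {d} → d ∈ᵇ C → ∣ (l * d - 2ℚ) * ¼ ∣ ≤ h - l
  ∣ld-2∣/4≤ {d} (l≤d , d≤h) = ∣x∣≤w ((l * d - 2ℚ) * ¼) (h - l)
    (subst (0ℚ ≤_) (r₁ l h d) (*-nonNeg (<⇒≤ 0<¼) (+-nonNeg (+-nonNeg
      (<⇒≤ (0<diff (proj₂ (lower C))))
      (*-nonNeg 0≤l (0≤diff d≤h)))
      (*-nonNeg (+-nonNeg 0≤2-l (<⇒≤ 0<2)) 0≤h-l))))
    (subst (0ℚ ≤_) (r₂ l h d) (*-nonNeg (<⇒≤ 0<¼) (+-nonNeg (+-nonNeg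
      (<⇒≤ (0<diff (proj₂ (upper C))))
      (*-nonNeg 0≤l (0≤diff l≤d)))
      (*-nonNeg (+-nonNeg 0≤2-h 0≤2-l) 0≤h-l))))
    where
    r₁ : ∀ l h d → ¼ * ((2ℚ - l * l) + l * (h - d) + (2ℚ - l + 2ℚ) * (h - l))
                 ≡ (h - l) - (l * d - 2ℚ) * ¼
    r₁ = solve-∀ ℚ-ring
    r₂ : ∀ l h d → ¼ * ((h * h - 2ℚ) + l * (d - l) + ((2ℚ - h) + (2ℚ - l)) * (h - l))
                 ≡ (h - l) + (l * d - 2ℚ) * ¼
    r₂ = solve-∀ ℚ-ring

  ∣l-d∣/2≤ : ∀ {d} → d ∈ᵇ C → ∣ (l - d) * ½ ∣ ≤ h - l
  ∣l-d∣/2≤ {d} (l≤d , d≤h) = ∣x∣≤w ((l - d) * ½) (h - l)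
    (subst (0ℚ ≤_) (r₁ l h d) (+-nonNeg 0≤h-l (*-nonNeg (0≤diff l≤d) (<⇒≤ 0<½))))
    (subst (0ℚ ≤_) (r₂ l h d) (*-nonNeg (<⇒≤ 0<½) (+-nonNeg (0≤diff d≤h) 0≤h-l)))
    where
    r₁ : ∀ l h d → (h - l) + (d - l) * ½ ≡ (h - l) - (l - d) * ½
    r₁ = solve-∀ ℚ-ring
    r₂ : ∀ l h d → ½ * ((h - d) + (h - l)) ≡ (h - l) + (l - d) * ½
    r₂ = solve-∀ ℚ-ring

-- The four identities compute the gaps between p = y + (x − y) e and the ends of the two intervals,
-- evaluated at a rational d in place of √2. Here x and y are the midpoints of the intervals,
-- x − y = A + B√2, and e = 1/2 + (c/4)√2 is close to 1 and its conjugate close to 0 when c is close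
-- to √2; so p is near x for the first order and near y for the second.

gap-above-α :
  ∀ αq αr βq βr γq γr δq δr c d →
  let A = (αq + βq) * ½ - (γq + δq) * ½
      B = (αr + βr) * ½ - (γr + δr) * ½
      pq = (γq + δq) * ½ + A * ½ + B * c * ½
      pr = (γr + δr) * ½ + A * c * ¼ + B * ½
  in (pr - αr) * d - (αq - pq)
     ≡ ½ * ((βr - αr) * d - (αq - βq)) + (A * ((c * d - 2ℚ) * ¼) + B * ((c - d) * ½))
gap-above-α = solve-∀ ℚ-ring

gap-below-β :
  ∀ αq αr βq βr γq γr δq δr c d →
  let A = (αq + βq) * ½ - (γq + δq) * ½
      B = (αr + βr) * ½ - (γr + δr) * ½
      pq = (γq + δq) * ½ + A * ½ + B * c * ½
      pr = (γr + δr) * ½ + A * c * ¼ + B * ½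
  in (βr - pr) * d - (pq - βq)
     ≡ ½ * ((βr - αr) * d - (αq - βq)) - (A * ((c * d - 2ℚ) * ¼) + B * ((c - d) * ½))
gap-below-β = solve-∀ ℚ-ring

gap-above-γ :
  ∀ αq αr βq βr γq γr δq δr c d →
  let A = (αq + βq) * ½ - (γq + δq) * ½
      B = (αr + βr) * ½ - (γr + δr) * ½
      pq = (γq + δq) * ½ + A * ½ + B * c * ½
      pr = (γr + δr) * ½ + A * c * ¼ + B * ½
  in (γr - pr) * d - (γq - pq)
     ≡ ½ * ((γr - δr) * d - (γq - δq)) + (A * - ((c * d - 2ℚ) * ¼) + B * ((c - d) * ½))
gap-above-γ = solve-∀ ℚ-ring

gap-below-δ :
  ∀ αq αr βq βr γq γr δq δr c d →
  let A = (αq + βq) * ½ - (γq + δq) * ½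
      B = (αr + βr) * ½ - (γr + δr) * ½
      pq = (γq + δq) * ½ + A * ½ + B * c * ½
      pr = (γr + δr) * ½ + A * c * ¼ + B * ½
  in (pr - δr) * d - (pq - δq)
     ≡ ½ * ((γr - δr) * d - (γq - δq)) - (A * - ((c * d - 2ℚ) * ¼) + B * ((c - d) * ½))
gap-below-δ = solve-∀ ℚ-ring

-- Near √2 both intervals have length at least `m`, so their midpoints are at least `m`/2 away from
-- the ends. The bracket is taken so narrow that the error of `p` against either midpoint stays
-- below `m`/2.
plus-minus-dense : ∀ {α β γ δ} → LtPlus α β → LtMinus γ δ →
        ∃[ p ] LtPlus α p × LtPlus p β × LtMinus γ p × LtMinus p δ
plus-minus-dense {αq , αr} {βq , βr} {γq , γr} {δq , δr} α<β γ<δ = approximate (common-margin {αq - βq} {βr - αr} {γq - δq} {γr - δr} α<β γ<δ)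
  where
  Goal : Set
  Goal = ∃[ p ] LtPlus (αq , αr) p × LtPlus p (βq , βr) × LtMinus (γq , γr) p × LtMinus p (δq , δr)
  A B : ℚ
  A = (αq + βq) * ½ - (γq + δq) * ½
  B = (αr + βr) * ½ - (γr + δr) * ½
  gap₁ gap₂ : ℚ → ℚ
  gap₁ d = (βr - αr) * d - (αq - βq)
  gap₂ d = (γr - δr) * d - (γq - δq)
  approximate : ∃[ m ] 0ℚ < m × Near (λ d → m ≤ gap₁ d × m ≤ gap₂ d) → Goal
  approximate (m , 0<m , D , gaps) =
    construct (narrow D (+-nonNeg (0≤∣p∣ A) (0≤∣p∣ B)) (*-pos 0<½ 0<m))
    where
    construct : ∃[ C ] C ⊆ᵇ D × C ⊆ᵇ [1,2] × (∣ A ∣ + ∣ B ∣) * (hi C - lo C) < ½ * m → Goal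
    construct (C , C⊆D , C⊆[1,2] , small) = (pq , pr) ,
      Near⇒LtSqrt2 {αq - pq} {pr - αr} (C , λ d d∈ → <-by (proj₁ (bound₁ d d∈)) (gap-above-α αq αr βq βr γq γr δq δr c d)) ,
      Near⇒LtSqrt2 {pq - βq} {βr - pr} (C , λ d d∈ → <-by (proj₂ (bound₁ d d∈)) (gap-below-β αq αr βq βr γq γr δq δr c d)) ,
      Near⇒LtSqrt2 {γq - pq} {γr - pr} (C , λ d d∈ → <-by (proj₁ (bound₂ d d∈)) (gap-above-γ αq αr βq βr γq γr δq δr c d)) ,
      Near⇒LtSqrt2 {pq - δq} {pr - δr} (C , λ d d∈ → <-by (proj₂ (bound₂ d d∈)) (gap-below-δ αq αr βq βr γq γr δq δr c d))
      where
      c pq pr : ℚ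
      c = lo C
      pq = (γq + δq) * ½ + A * ½ + B * c * ½
      pr = (γr + δr) * ½ + A * c * ¼ + B * ½
      raise : ∀ {g} x → m ≤ g → 0ℚ < ½ * m + x → 0ℚ < ½ * g + x
      raise x m≤g 0< = <-≤-trans 0< (+-monoˡ-≤ x (*-monoˡ-≤-nonNeg ½ m≤g))
      bound : ∀ g s d → ∣ s ∣ ≤ hi C - c → d ∈ᵇ C → m ≤ g →
              let err = A * s + B * ((c - d) * ½) in 0ℚ < ½ * g + err × 0ℚ < ½ * g - err
      bound g s d ∣s∣≤w d∈ m≤g = Product.map (raise err m≤g) (raise (- err) m≤g)
        (∣x∣<m err (½ * m) (≤-<-trans
          (∣as+bt∣≤ A B s ((c - d) * ½) ∣s∣≤w (∣l-d∣/2≤ C C⊆[1,2] d∈)) small))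
        where
        err : ℚ
        err = A * s + B * ((c - d) * ½)
      bound₁ : ∀ d (d∈ : d ∈ᵇ C) → _
      bound₁ d d∈ = bound (gap₁ d) ((c * d - 2ℚ) * ¼) d
        (∣ld-2∣/4≤ C C⊆[1,2] d∈) d∈ (proj₁ (gaps d (C⊆D d d∈)))
      -- At `d`, e - 1 is (cd - 2)/4, while the conjugate of e is 1/2 - cd/4, its negative; hence
      -- the sign in the second order.
      bound₂ : ∀ d (d∈ : d ∈ᵇ C) → _
      bound₂ d d∈ = bound (gap₂ d) (- ((c * d - 2ℚ) * ¼)) d
        (subst (_≤ hi C - c) (sym (∣-p∣≡∣p∣ ((c * d - 2ℚ) * ¼))) (∣ld-2∣/4≤ C C⊆[1,2] d∈)) d∈
        (proj₂ (gaps d (C⊆D d d∈)))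

-- Cuts in unbounded orders and greedy extension

Rank : ∀ {n} → Permutation n n → Fin n → Fin n → Set
Rank π i j = π ⟨$⟩ʳ i Fin.< π ⟨$⟩ʳ j

Rank-total : ∀ {n} (π : Permutation n n) {i j} → i ≢ j → Rank π i j ⊎ Rank π j i
Rank-total π {i} {j} i≢j with Fin.<-cmp (π ⟨$⟩ʳ i) (π ⟨$⟩ʳ j)
... | tri< i<j _ _ = inj₁ i<j
... | tri≈ _ eq _  = contradiction (trans (sym (inverseˡ π)) (trans (cong (π ⟨$⟩ˡ_) eq) (inverseˡ π))) i≢j
... | tri> _ _ j<i = inj₂ j<i

-- `origin` and the two unboundedness fields provide bounds when one side of a cut is empty.
record UnboundedOrder (V : Set) : Set₁ where
  infix 4 _≺_
  field
    _≺_                : V → V → Set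
    isStrictTotalOrder : IsStrictTotalOrder _≡_ _≺_
    origin             : V
    below              : ∀ v → ∃[ u ] u ≺ v
    above              : ∀ v → ∃[ w ] v ≺ w

  open IsStrictTotalOrder isStrictTotalOrder public
    using (compare; _≟_) renaming (trans to ≺-trans; irrefl to ≺-irrefl; asym to ≺-asym; _<?_ to _≺?_)

module _ {V : Set} (O : UnboundedOrder V) where

  open UnboundedOrder O

  infix 4 _≼_
  _≼_ : V → V → Set
  u ≼ v = u ≡ v ⊎ u ≺ v

  ≼-≺-trans : ∀ {u v w} → u ≼ v → v ≺ w → u ≺ w
  ≼-≺-trans (inj₁ refl) v≺w = v≺w
  ≼-≺-trans (inj₂ u≺v)  v≺w = ≺-trans u≺v v≺w

  ≺-≼-trans : ∀ {u v w} → u ≺ v → v ≼ w → u ≺ w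
  ≺-≼-trans u≺v (inj₁ refl) = u≺v
  ≺-≼-trans u≺v (inj₂ v≺w)  = ≺-trans u≺v v≺w

  ≺-or-≽ : ∀ u v → u ≺ v ⊎ v ≼ u
  ≺-or-≽ u v with compare u v
  ... | tri< u≺v _ _ = inj₁ u≺v
  ... | tri≈ _ u≡v _ = inj₂ (inj₁ (sym u≡v))
  ... | tri> _ _ v≺u = inj₂ (inj₂ v≺u)

  above-all : ∀ us → ∃[ β ] All (_≺ β) us
  above-all []       = origin , []
  above-all (u ∷ us) with above-all us
  ... | β , us≺β with ≺-or-≽ u β
  ...   | inj₁ u≺β = β , u≺β ∷ us≺β
  ...   | inj₂ β≼u with above u
  ...     | γ , u≺γ = γ , u≺γ ∷ All.map (λ x≺β → ≺-trans (≺-≼-trans x≺β β≼u) u≺γ) us≺β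

  -- `β` is the minimum of `vs` together with one strict upper bound of `us`, which is the value for
  -- empty `vs`.
  least-upper : ∀ us vs → All (λ v → All (_≺ v) us) vs → ∃[ β ] All (_≺ β) us × All (β ≼_) vs
  least-upper us [] [] = let β , us≺β = above-all us in β , us≺β , []
  least-upper us (v ∷ vs) (us≺v ∷ us≺vs) with least-upper us vs us≺vs
  ... | β , us≺β , β≼vs with ≺-or-≽ v β
  ...   | inj₁ v≺β = v , us≺v , inj₁ refl ∷ All.map (λ β≼x → inj₂ (≺-≼-trans v≺β β≼x)) β≼vs
  ...   | inj₂ β≼v = β , us≺β , β≼v ∷ β≼vs

  -- Starting from some point below `β`, `α` is raised to every `z` found strictly between, until
  -- the open interval contains none.
  avoid-below : ∀ β zs → ∃[ α ] α ≺ β × All (λ z → z ≼ α ⊎ β ≼ z) zs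
  avoid-below β [] = let α , α≺β = below β in α , α≺β , []
  avoid-below β (z ∷ zs) with avoid-below β zs | ≺-or-≽ z β
  ... | α , α≺β , gap | inj₂ β≼z = α , α≺β , inj₂ β≼z ∷ gap
  ... | α , α≺β , gap | inj₁ z≺β with ≺-or-≽ α z
  ...   | inj₂ z≼α = α , α≺β , inj₁ z≼α ∷ gap
  ...   | inj₁ α≺z = z , z≺β , inj₁ (inj₁ refl) ∷ All.map (Sum.map₁ (λ x≼α → inj₂ (≼-≺-trans x≼α α≺z))) gap

  cut : ∀ us vs zs → All (λ v → All (_≺ v) us) vs →
        ∃[ α ] ∃[ β ] α ≺ β × (∀ {p} → α ≺ p → p ≺ β → All (_≺ p) us × All (p ≺_) vs × p ∉ zs)
  cut us vs zs us≺vs with least-upper us vs us≺vs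
  -- Adding `us` to the avoided points places it on the left: its members are below `β`, so the gap
  -- forces them to be at most `α`.
  ... | β , us≺β , β≼vs with avoid-below β (us ++ zs)
  ...   | α , α≺β , gap = α , β , α≺β , λ {p} α≺p p≺β →
          All.zipWith (λ (x≺β , gapₓ) → below-p α≺p x≺β gapₓ) (us≺β , All.++⁻ˡ us gap) ,
          All.map (≺-≼-trans p≺β) β≼vs ,
          λ p∈zs → [ (λ p≼α → ≺-irrefl refl (≼-≺-trans p≼α α≺p)) , (λ β≼p → ≺-irrefl refl (≺-≼-trans p≺β β≼p)) ]′
                     (All.lookup (All.++⁻ʳ us gap) p∈zs)
    where
    below-p : ∀ {p x} → α ≺ p → x ≺ β → x ≼ α ⊎ β ≼ x → x ≺ p
    below-p α≺p x≺β (inj₁ x≼α) = ≼-≺-trans x≼α α≺p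
    below-p α≺p x≺β (inj₂ β≼x) = ⊥-elim (≺-irrefl refl (≺-≼-trans x≺β β≼x))

  -- The placed vertices ranked before `i` form the left side of the cut and those ranked after `i`
  -- the right side; monotonicity separates the sides.
  cut-at-rank : ∀ {n} (π : Permutation n n) (f : Fin n → V) done i zs →
    (∀ {j k} → j ∈ done → k ∈ done → j ≢ k → Rank π j k → f j ≺ f k) →
    ∃[ α ] ∃[ β ] α ≺ β × (∀ {p} → α ≺ p → p ≺ β →
      (∀ {j} → j ∈ done → (Rank π j i → f j ≺ p) × (Rank π i j → p ≺ f j)) × p ∉ zs)
  cut-at-rank π f done i zs mono = α , β , α≺β , λ α≺p p≺β →
      let us≺p , p≺vs , p∉zs = cut-property α≺p p≺β in
      (λ j∈ → (λ j<i → All.lookup us≺p (∈-map⁺ f (∈-filter⁺ low? j∈ j<i))) ,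
              (λ i<j → All.lookup p≺vs (∈-map⁺ f (∈-filter⁺ high? j∈ i<j)))) ,
      p∉zs
    where
    low? = λ j → π ⟨$⟩ʳ j Fin.<? π ⟨$⟩ʳ i
    high? = λ j → π ⟨$⟩ʳ i Fin.<? π ⟨$⟩ʳ j
    us = map f (filter low? done)
    vs = map f (filter high? done)
    us≺vs : ∀ {u v} → u ∈ us → v ∈ vs → u ≺ v
    us≺vs u∈ v∈ with ∈-map⁻ f u∈ | ∈-map⁻ f v∈
    ... | j , j∈ , refl | k , k∈ , refl with ∈-filter⁻ low? j∈ | ∈-filter⁻ high? k∈
    ...   | j∈done , j<i | k∈done , i<k =
            mono j∈done k∈done (λ { refl → Fin.<-asym j<i i<k }) (Fin.<-trans j<i i<k)
    the-cut = cut us vs zs (All.tabulate λ v∈ → All.tabulate λ u∈ → us≺vs u∈ v∈)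
    α = proj₁ the-cut
    β = proj₁ (proj₂ the-cut)
    α≺β = proj₁ (proj₂ (proj₂ the-cut))
    cut-property = proj₂ (proj₂ (proj₂ the-cut))

Compatible : ∀ {n} {V : Set} → (Fin n → Fin n → V → V → Set) → (Fin n → V) → List (Fin n) → Set
Compatible G f done = ∀ {i j} → i ∈ done → j ∈ done → i ≢ j → G i j (f i) (f j)

Compatible-pair : ∀ {n} {V : Set} (G : Fin n → Fin n → V → V → Set) f {x y} →
  G x y (f x) (f y) → G y x (f y) (f x) → Compatible G f (x ∷ y ∷ [])
Compatible-pair G f xy yx (here refl)         (here refl)         x≢x = contradiction refl x≢x
Compatible-pair G f xy yx (here refl)         (there (here refl)) _   = xy
Compatible-pair G f xy yx (there (here refl)) (here refl)         _   = yx
Compatible-pair G f xy yx (there (here refl)) (there (here refl)) y≢y = contradiction refl y≢y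

module _ {n} {V : Set} (G : Fin n → Fin n → V → V → Set)
         (extend : ∀ f done i → i ∉ done → Compatible G f done →
                   ∃[ p ] (∀ {j} → j ∈ done → G i j p (f j) × G j i (f j) p)) where

  open import Data.List.Membership.DecPropositional (Fin._≟_ {n}) using (_∈?_)

  -- Indices already in `done` are skipped and keep their values, so a prescribed initial pair
  -- survives the extension.
  extend-along : ∀ todo f done → Compatible G f done →
    ∃[ g ] ∃[ done′ ] Compatible G g done′ × (∀ {i} → i ∈ todo → i ∈ done′) ×
                      (∀ {i} → i ∈ done → i ∈ done′ × g i ≡ f i)
  extend-along [] f done good = f , done , good , (λ ()) , (λ i∈ → i∈ , refl)
  extend-along (i ∷ todo) f done good with i ∈? done
  ... | yes i∈done with extend-along todo f done good
  ...   | g , done′ , good′ , todo⊆ , agree =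
          g , done′ , good′ , (λ { (here refl) → proj₁ (agree i∈done) ; (there j∈) → todo⊆ j∈ }) , agree
  extend-along (i ∷ todo) f done good | no i∉done with extend f done i i∉done good
  ... | p , new with extend-along todo f′ (i ∷ done) good⁺
    where
    f′ : Fin n → V
    f′ = updateAt f i (λ _ → p)
    old : ∀ {j} → j ∈ done → f′ j ≡ f j
    old {j} j∈ = updateAt-minimal j i f (λ { refl → i∉done j∈ })
    good⁺ : Compatible G f′ (i ∷ done)
    good⁺ (here refl) (here refl) i≢i = ⊥-elim (i≢i refl)
    good⁺ (here refl) (there j∈) _
      rewrite updateAt-updates i {λ _ → p} f | old j∈ = proj₁ (new j∈)
    good⁺ (there j∈) (here refl) _
      rewrite updateAt-updates i {λ _ → p} f | old j∈ = proj₂ (new j∈)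
    good⁺ (there j∈) (there k∈) j≢k rewrite old j∈ | old k∈ = good j∈ k∈ j≢k
  ...   | g , done′ , good′ , todo⊆ , agree =
          g , done′ , good′ , (λ { (here refl) → proj₁ (agree (here refl)) ; (there j∈) → todo⊆ j∈ }) ,
          λ {j} j∈ → proj₁ (agree (there j∈)) ,
            trans (proj₂ (agree (there j∈))) (updateAt-minimal j i f (λ { refl → i∉done j∈ }))

  extend-to-all : ∀ f done → Compatible G f done →
    ∃[ g ] (∀ {i} → i ∈ done → g i ≡ f i) × (∀ {i j} → i ≢ j → G i j (g i) (g j))
  extend-to-all f done good with extend-along (allFin n) f done good
  ... | g , done′ , good′ , all∈ , agree =
    g , (λ i∈ → proj₂ (agree i∈)) , good′ (all∈ (∈-allFin _)) (all∈ (∈-allFin _))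

-- Permutation graphs and dense pairs of orders

-- If `y` were missed, punching it out would inject `Fin (suc n)` into `Fin n`, against the
-- pigeonhole principle.
injective⇒surjective : ∀ {n} (g : Fin n → Fin n) → (∀ {i j} → g i ≡ g j → i ≡ j) →
                       ∀ y → ∃[ x ] g x ≡ y
injective⇒surjective {suc n} g g-inj y with Fin.any? (λ x → g x Fin.≟ y)
... | yes hit = hit
... | no miss =
  let i , j , i<j , eq = Fin.pigeonhole (ℕₚ.n<1+n n) (λ x → punchOut (y≢g x))
  in ⊥-elim (Fin.<⇒≢ i<j (g-inj (Fin.punchOut-injective (y≢g i) (y≢g j) eq)))
  where
  y≢g : ∀ x → y ≢ g x
  y≢g x y≡gx = miss (x , sym y≡gx)

injective⇒permutation : ∀ {n} (g : Fin n → Fin n) → (∀ {i j} → g i ≡ g j → i ≡ j) →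
                        ∃[ π ] (∀ i → π ⟨$⟩ʳ i ≡ g i)
injective⇒permutation g g-inj =
  permutation g (λ y → proj₁ (onto y)) (λ y → proj₂ (onto y)) (λ x → g-inj (proj₂ (onto (g x)))) ,
  λ _ → refl
  where onto = injective⇒surjective g g-inj

module _ {V : Set} (O : UnboundedOrder V) where

  open UnboundedOrder O

  -- The rank of `i` is the number of `j` with `f j` below `f i`. It is strictly monotone because
  -- the sets `↓ i` are strictly nested.
  sort : ∀ {n} (f : Fin n → V) → (∀ {i j} → f i ≡ f j → i ≡ j) →
         ∃[ π ] (∀ {i j} → f i ≺ f j ⇔ Rank π i j)
  sort {n} f f-inj = π , λ {i} {j} → mk⇔ (rank-mono i j) (rank-reflects i j)
    where
    ↓_ : Fin n → Subset.Subset n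
    ↓ i = tabulate (λ j → does (f j ≺? f i))
    ∈↓⇒≺ : ∀ {i j} → j Subset.∈ ↓ i → f j ≺ f i
    ∈↓⇒≺ {i} {j} j∈ with f j ≺? f i | trans (sym (lookup∘tabulate _ j)) ([]=⇒lookup j∈)
    ... | yes j≺i | _ = j≺i
    ≺⇒∈↓ : ∀ {i j} → f j ≺ f i → j Subset.∈ ↓ i
    ≺⇒∈↓ {i} {j} j≺i = lookup⇒[]= j _ (trans (lookup∘tabulate _ j) (dec-true (f j ≺? f i) j≺i))
    i∉↓i : ∀ {i} → ¬ i Subset.∈ ↓ i
    i∉↓i i∈ = ≺-irrefl refl (∈↓⇒≺ i∈)
    ∣↓∣<n : ∀ i → Subset.∣ ↓ i ∣ ℕ.< n
    ∣↓∣<n i = subst (Subset.∣ ↓ i ∣ ℕ.<_) (Subset.∣⊤∣≡n n)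
      (Subset.p⊂q⇒∣p∣<∣q∣ ((λ _ → Subset.∈⊤) , i , Subset.∈⊤ , i∉↓i))
    ∣↓∣-mono : ∀ {i j} → f i ≺ f j → Subset.∣ ↓ i ∣ ℕ.< Subset.∣ ↓ j ∣
    ∣↓∣-mono {i} i≺j = Subset.p⊂q⇒∣p∣<∣q∣
      ((λ k∈ → ≺⇒∈↓ (≺-trans (∈↓⇒≺ k∈) i≺j)) , i , ≺⇒∈↓ i≺j , i∉↓i)
    rank : Fin n → Fin n
    rank i = fromℕ< (∣↓∣<n i)
    rank< : ∀ {i j} → f i ≺ f j → rank i Fin.< rank j
    rank< {i} {j} i≺j = subst₂ ℕ._<_ (sym (Fin.toℕ-fromℕ< (∣↓∣<n i)))
                          (sym (Fin.toℕ-fromℕ< (∣↓∣<n j))) (∣↓∣-mono i≺j)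
    rank-injective : ∀ {i j} → rank i ≡ rank j → i ≡ j
    rank-injective {i} {j} eq with compare (f i) (f j)
    ... | tri< i≺j _ _ = ⊥-elim (Fin.<-irrefl eq (rank< i≺j))
    ... | tri≈ _ i≡j _ = f-inj i≡j
    ... | tri> _ _ j≺i = ⊥-elim (Fin.<-irrefl (sym eq) (rank< j≺i))
    π : Permutation n n
    π = proj₁ (injective⇒permutation rank rank-injective)
    rank-mono : ∀ i j → f i ≺ f j → Rank π i j
    rank-mono i j = rank<
    rank-reflects : ∀ i j → Rank π i j → f i ≺ f j
    rank-reflects i j i<j with compare (f i) (f j)
    ... | tri< i≺j _ _ = i≺j
    ... | tri≈ _ i≡j _ = ⊥-elim (Fin.<-irrefl (cong rank (f-inj i≡j)) i<j)
    ... | tri> _ _ j≺i = ⊥-elim (Fin.<-asym i<j (rank< j≺i))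

-- The disjuncts are arranged as in `UAdj`, which is thus an instance by definition.
Concordant : ∀ {A : Set} → (A → A → Set) → (A → A → Set) → A → A → Set
Concordant R S x y = (R x y × S x y) ⊎ (R y x × S y x)

-- Vertices are labelled by their first rank, and σ sends a first rank to the second rank of the
-- same vertex.
ranks⇒permutationGraph : ∀ {n} (a : Fin n → Fin n → Bool) (π ρ : Permutation n n) →
  (∀ {i j} → i ≢ j → (a i j ≡ true) ⇔ Concordant (Rank π) (Rank ρ) i j) → IsPermutationGraph n a
ranks⇒permutationGraph a π ρ conc = flip π , flip π ∘ₚ ρ , λ i j i<j →
  let πi<πj : Rank π (π ⟨$⟩ˡ i) (π ⟨$⟩ˡ j)
      πi<πj = subst₂ Fin._<_ (sym (inverseʳ π)) (sym (inverseʳ π)) i<j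
      e = conc {π ⟨$⟩ˡ i} {π ⟨$⟩ˡ j} (λ eq → Fin.<-irrefl (cong (π ⟨$⟩ʳ_) eq) πi<πj)
  in mk⇔ (λ aij → [ proj₂ , (λ (πj<πi , _) → ⊥-elim (Fin.<-asym πi<πj πj<πi)) ]′ (Equivalence.to e aij))
         (λ ρi<ρj → Equivalence.from e (inj₁ (πi<πj , ρi<ρj)))

-- The first rank is the position in the labelling, the second its image under σ; symmetry of `a`
-- covers the pairs listed in decreasing order.
permutationGraph⇒ranks : ∀ {n} (a : Fin n → Fin n → Bool) → (∀ i j → a i j ≡ a j i) →
  IsPermutationGraph n a →
  ∃[ π ] ∃[ ρ ] (∀ {i j} → i ≢ j → (a i j ≡ true) ⇔ Concordant (Rank π) (Rank ρ) i j)
permutationGraph⇒ranks {n} a a-sym (lab , σ , edge) = π , ρ , conc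
  where
  π ρ : Permutation n n
  π = flip lab
  ρ = flip lab ∘ₚ σ
  edge′ : ∀ {i j} → Rank π i j → (a i j ≡ true) ⇔ Rank ρ i j
  edge′ {i} {j} i<j = subst₂ (λ k l → (a k l ≡ true) ⇔ Rank ρ i j) (inverseʳ lab) (inverseʳ lab)
                        (edge (π ⟨$⟩ʳ i) (π ⟨$⟩ʳ j) i<j)
  conc : ∀ {i j} → i ≢ j → (a i j ≡ true) ⇔ Concordant (Rank π) (Rank ρ) i j
  conc {i} {j} i≢j with Rank-total π i≢j
  ... | inj₁ i<j = mk⇔ (λ aij → inj₁ (i<j , Equivalence.to (edge′ i<j) aij))
          [ (λ (_ , s) → Equivalence.from (edge′ i<j) s) , (λ (j<i , _) → contradiction j<i (Fin.<-asym i<j)) ]′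
  ... | inj₂ j<i = mk⇔ (λ aij → inj₂ (j<i , Equivalence.to (edge′ j<i) (trans (a-sym j i) aij)))
          [ (λ (i<j , _) → contradiction i<j (Fin.<-asym j<i)) , (λ (_ , s) → trans (a-sym i j) (Equivalence.from (edge′ j<i) s)) ]′

-- What the saturation argument uses of U: two unbounded orders so independent that an interval of
-- one always meets an interval of the other.
record DenseBiorder (V : Set) : Set₁ where
  field
    O₁ O₂ : UnboundedOrder V
  open UnboundedOrder O₁ public using () renaming (_≺_ to _≺₁_)
  open UnboundedOrder O₂ public using () renaming (_≺_ to _≺₂_)
  field
    dense : ∀ {α β γ δ} → α ≺₁ β → γ ≺₂ δ → ∃[ p ] α ≺₁ p × p ≺₁ β × γ ≺₂ p × p ≺₂ δ

module _ {V : Set} (U : DenseBiorder V) where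

  open DenseBiorder U

  induced⇒permutationGraph : ∀ {n} (a : Fin n → Fin n → Bool) (f : Fin n → V) →
    (∀ {i j} → f i ≡ f j → i ≡ j) →
    (∀ {i j} → i ≢ j → (a i j ≡ true) ⇔ Concordant _≺₁_ _≺₂_ (f i) (f j)) → IsPermutationGraph n a
  induced⇒permutationGraph {n} a f f-inj edge
    with π , ≺₁⇔π ← sort O₁ f f-inj | ρ , ≺₂⇔ρ ← sort O₂ f f-inj
    = ranks⇒permutationGraph a π ρ λ i≢j → mk⇔
        (λ aij → Sum.map (Product.map (to ≺₁⇔π) (to ≺₂⇔ρ)) (Product.map (to ≺₁⇔π) (to ≺₂⇔ρ)) (to (edge i≢j) aij))
        (λ c → from (edge i≢j) (Sum.map (Product.map (from ≺₁⇔π) (from ≺₂⇔ρ)) (Product.map (from ≺₁⇔π) (from ≺₂⇔ρ)) c))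
    where open Equivalence

  module _ {P : V → V → Set} (P-sym : ∀ u v → P u v → P v u)
           (locFinite : ∀ u → Σ (List V) λ L → ∀ v → P u v → v ∈ L)
           {n} (π ρ : Permutation n n) (Fixed : Fin n → Fin n → Set) where

    -- Fixed marks the pairs of indices whose images are allowed to be P-related.
    Placed : Fin n → Fin n → V → V → Set
    Placed i j x y = ((Rank π i j → x ≺₁ y) × (Rank ρ i j → x ≺₂ y)) × (¬ Fixed i j → ¬ P x y)

    neighbours : (Fin n → V) → List (Fin n) → List V
    neighbours f = concatMap (λ j → proj₁ (locFinite (f j)))

    ∉neighbours⇒¬P : ∀ f done {p j} → p ∉ neighbours f done → j ∈ done → ¬ P (f j) p
    ∉neighbours⇒¬P f done p∉ j∈ Pfjp = p∉ (∈-concatMap⁺ _ (lose j∈ (proj₂ (locFinite (f _)) _ Pfjp)))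

    -- The ranks of `i` cut out an interval in each order, and joint density gives a common point.
    -- The first interval already avoids the finitely many `P`-partners of placed vertices, so the
    -- second cut avoids the empty list.
    place : ∀ f done i → i ∉ done → Compatible Placed f done →
            ∃[ p ] (∀ {j} → j ∈ done → Placed i j p (f j) × Placed j i (f j) p)
    place f done i i∉done good
      with α , β , α≺β , cut₁ ← cut-at-rank O₁ π f done i (neighbours f done)
                                  (λ j∈ k∈ j≢k → proj₁ (proj₁ (good j∈ k∈ j≢k)))
         | γ , δ , γ≺δ , cut₂ ← cut-at-rank O₂ ρ f done i []
                                  (λ j∈ k∈ j≢k → proj₂ (proj₁ (good j∈ k∈ j≢k)))
      with p , α≺p , p≺β , γ≺p , p≺δ ← dense α≺β γ≺δ
      with sides₁ , p∉ ← cut₁ α≺p p≺β | sides₂ , _ ← cut₂ γ≺p p≺δ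
      = p , λ {j} j∈ →
        ((proj₂ (sides₁ j∈) , proj₂ (sides₂ j∈)) , λ _ Ppj → ∉neighbours⇒¬P f done p∉ j∈ (P-sym _ _ Ppj)) ,
        ((proj₁ (sides₁ j∈) , proj₁ (sides₂ j∈)) , λ _ → ∉neighbours⇒¬P f done p∉ j∈)

    embed : ∀ f done → Compatible Placed f done →
      ∃[ g ] (∀ {i} → i ∈ done → g i ≡ f i) × (∀ {i j} → i ≢ j → Placed i j (g i) (g j))
    embed = extend-to-all Placed place

-- The two orders of the up and right graph

diff-+ : ∀ x y z → (x - y) + (y - z) ≡ x - z
diff-+ = solve-∀ ℚ-ring

neg-diff : ∀ x y → - (x - y) ≡ y - x
neg-diff = solve-∀ ℚ-ring

diff≡0⇒≡ : ∀ x y → x - y ≡ 0ℚ → x ≡ y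
diff≡0⇒≡ x y eq = begin
  x            ≡⟨ x+[y-x]≡y y x ⟨
  y + (x - y)  ≡⟨ cong (y +_) eq ⟩
  y + 0ℚ       ≡⟨ +-identityʳ y ⟩
  y            ∎
  where open ≡-Reasoning

LtSqrt2-chain : ∀ {a b c d e f} → a + c ≡ e → b + d ≡ f → LtSqrt2 a b → LtSqrt2 c d → LtSqrt2 e f
LtSqrt2-chain {a} {b} {c} {d} refl refl lt lt′ =
  Near⇒LtSqrt2 {a + c} {b + d} (LtSqrt2-+ {a} {b} {c} {d} lt lt′)

LtSqrt2-diff-cmp : ∀ x y s t → LtSqrt2 (x - y) (s - t) ⊎ LtSqrt2 (y - x) (t - s) ⊎ (x ≡ y × s ≡ t)
LtSqrt2-diff-cmp x y s t = Sum.map₂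
  (Sum.map (subst₂ LtSqrt2 (neg-diff x y) (neg-diff s t))
           (λ (x-y≡0 , s-t≡0) → diff≡0⇒≡ x y x-y≡0 , diff≡0⇒≡ s t s-t≡0))
  (LtSqrt2-cmp (x - y) (s - t))

LtSqrt2-diff-irrefl : ∀ x s → ¬ LtSqrt2 (x - x) (s - s)
LtSqrt2-diff-irrefl x s lt = LtSqrt2-irrefl (subst₂ LtSqrt2 (+-inverseʳ x) (+-inverseʳ s) lt)

trichotomous : ∀ {V : Set} {_≺_ : V → V → Set} → (∀ u → ¬ u ≺ u) →
  (∀ {u v w} → u ≺ v → v ≺ w → u ≺ w) → (∀ u v → u ≺ v ⊎ v ≺ u ⊎ u ≡ v) → Trichotomous _≡_ _≺_
trichotomous irrefl ≺-trans cmp u v with cmp u v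
... | inj₁ u≺v        = tri< u≺v (λ { refl → irrefl u u≺v }) (λ v≺u → irrefl u (≺-trans u≺v v≺u))
... | inj₂ (inj₁ v≺u) = tri> (λ u≺v → irrefl u (≺-trans u≺v v≺u)) (λ { refl → irrefl u v≺u }) v≺u
... | inj₂ (inj₂ refl) = tri≈ (irrefl u) refl (irrefl u)

LtPlus-trans : ∀ {u v w} → LtPlus u v → LtPlus v w → LtPlus u w
LtPlus-trans {q , r} {s , t} {x , y} =
  LtSqrt2-chain {q - s} {t - r} {s - x} {y - t} (diff-+ q s x) (trans (+-comm (t - r) (y - t)) (diff-+ y t r))

LtMinus-trans : ∀ {u v w} → LtMinus u v → LtMinus v w → LtMinus u w
LtMinus-trans {q , r} {s , t} {x , y} =
  LtSqrt2-chain {q - s} {r - t} {s - x} {t - y} (diff-+ q s x) (diff-+ r t y)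

LtPlus-compare : Trichotomous _≡_ LtPlus
LtPlus-compare = trichotomous (λ (q , r) → LtSqrt2-diff-irrefl q r)
  (λ {u} {v} {w} → LtPlus-trans {u} {v} {w})
  (λ (q , r) (s , t) → Sum.map₂ (Sum.map₂ λ { (refl , refl) → refl }) (LtSqrt2-diff-cmp q s t r))

LtMinus-compare : Trichotomous _≡_ LtMinus
LtMinus-compare = trichotomous (λ (q , r) → LtSqrt2-diff-irrefl q r)
  (λ {u} {v} {w} → LtMinus-trans {u} {v} {w})
  (λ (q , r) (s , t) → Sum.map₂ (Sum.map₂ λ { (refl , refl) → refl }) (LtSqrt2-diff-cmp q s r t))

-- Raising `q` by 1 leaves `r - r` as second argument in both orders, so one proof serves `LtPlus`
-- and `LtMinus`.
LtSqrt2-step : ∀ q r → LtSqrt2 (q - (q + 1ℚ)) (r - r)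
LtSqrt2-step q r = subst₂ LtSqrt2 (sym (ring q)) (sym (+-inverseʳ r))
  (inj₂ (≤-refl , negative⁻¹ (- 1ℚ) , 0<1))
  where
  ring : ∀ q → q - (q + 1ℚ) ≡ - 1ℚ
  ring = solve-∀ ℚ-ring

LtSqrt2-step′ : ∀ q r → LtSqrt2 ((q - 1ℚ) - q) (r - r)
LtSqrt2-step′ q r = subst (λ x → LtSqrt2 x (r - r)) (ring q) (LtSqrt2-step q r)
  where
  ring : ∀ q → q - (q + 1ℚ) ≡ (q - 1ℚ) - q
  ring = solve-∀ ℚ-ring

plusOrder : UnboundedOrder (ℚ × ℚ)
plusOrder = record
  { _≺_                = LtPlus
  ; isStrictTotalOrder = isStrictTotalOrderᶜ (record
      { isEquivalence = isEquivalence
      ; trans         = λ {u} {v} {w} → LtPlus-trans {u} {v} {w}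
      ; compare       = LtPlus-compare
      })
  ; origin             = 0ℚ , 0ℚ
  ; below              = λ (q , r) → (q - 1ℚ , r) , LtSqrt2-step′ q r
  ; above              = λ (q , r) → (q + 1ℚ , r) , LtSqrt2-step q r
  }

minusOrder : UnboundedOrder (ℚ × ℚ)
minusOrder = record
  { _≺_                = LtMinus
  ; isStrictTotalOrder = isStrictTotalOrderᶜ (record
      { isEquivalence = isEquivalence
      ; trans         = λ {u} {v} {w} → LtMinus-trans {u} {v} {w}
      ; compare       = LtMinus-compare
      })
  ; origin             = 0ℚ , 0ℚ
  ; below              = λ (q , r) → (q - 1ℚ , r) , LtSqrt2-step′ q r
  ; above              = λ (q , r) → (q + 1ℚ , r) , LtSqrt2-step q r
  }

upRight : DenseBiorder (ℚ × ℚ)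
upRight = record { O₁ = plusOrder ; O₂ = minusOrder ; dense = λ {α} {β} {γ} {δ} → plus-minus-dense {α} {β} {γ} {δ} }

-- Toggling and perturbing

Pair : ∀ {A : Set} → A → A → A → A → Set
Pair u v x y = (x ≡ u × y ≡ v) ⊎ (x ≡ v × y ≡ u)

Pair-sym : ∀ {A : Set} {u v x y : A} → Pair u v x y → Pair u v y x
Pair-sym (inj₁ (x≡u , y≡v)) = inj₂ (y≡v , x≡u)
Pair-sym (inj₂ (x≡v , y≡u)) = inj₁ (y≡u , x≡v)

Pair-map : ∀ {A B : Set} (f : A → B) {u v x y} → Pair u v x y → Pair (f u) (f v) (f x) (f y)
Pair-map f = Sum.map (Product.map (cong f) (cong f)) (Product.map (cong f) (cong f))

Pair-respects : ∀ {A : Set} {R : A → A → Set} → (∀ x y → R x y → R y x) →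
                ∀ {u v x y} → R u v → Pair u v x y → R x y
Pair-respects R-sym Ruv (inj₁ (refl , refl)) = Ruv
Pair-respects R-sym Ruv (inj₂ (refl , refl)) = R-sym _ _ Ruv

Pair-unique : ∀ {A : Set} {u v x y s t : A} → Pair u v x y → Pair u v s t → Pair x y s t
Pair-unique (inj₁ (refl , refl)) p = p
Pair-unique (inj₂ (refl , refl)) p = Sum.swap p

pair? : ∀ {A : Set} → ((x y : A) → Dec (x ≡ y)) → ∀ u v x y → Dec (Pair u v x y)
pair? _≟_ u v x y = (x ≟ u ×-dec y ≟ v) ⊎-dec (x ≟ v ×-dec y ≟ u)

toggle-pair : ∀ {n} (f : Fin n → Fin n → Bool) a b {i j} → Pair a b i j → toggle f a b i j ≡ not (f i j)
toggle-pair f a b {i} {j} pair with i Fin.≟ a | j Fin.≟ b | i Fin.≟ b | j Fin.≟ a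
... | yes _   | yes _   | _       | _       = refl
... | yes _   | no _    | yes _   | yes _   = refl
... | no _    | _       | yes _   | yes _   = refl
... | no i≢a  | _       | no i≢b  | _       = ⊥-elim ([ i≢a ∘ proj₁ , i≢b ∘ proj₁ ]′ pair)
... | no i≢a  | _       | _       | no j≢a  = ⊥-elim ([ i≢a ∘ proj₁ , j≢a ∘ proj₂ ]′ pair)
... | _       | no j≢b  | no i≢b  | _       = ⊥-elim ([ j≢b ∘ proj₂ , i≢b ∘ proj₁ ]′ pair)
... | _       | no j≢b  | _       | no j≢a  = ⊥-elim ([ j≢b ∘ proj₂ , j≢a ∘ proj₂ ]′ pair)

toggle-other : ∀ {n} (f : Fin n → Fin n → Bool) a b {i j} → ¬ Pair a b i j → toggle f a b i j ≡ f i j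
toggle-other f a b {i} {j} ¬pair with i Fin.≟ a | j Fin.≟ b | i Fin.≟ b | j Fin.≟ a
... | yes i≡a | yes j≡b | _       | _       = ⊥-elim (¬pair (inj₁ (i≡a , j≡b)))
... | _       | _       | yes i≡b | yes j≡a = ⊥-elim (¬pair (inj₂ (i≡b , j≡a)))
... | yes _   | no _    | yes _   | no _    = refl
... | yes _   | no _    | no _    | _       = refl
... | no _    | _       | yes _   | no _    = refl
... | no _    | _       | no _    | _       = refl

toggle-sym : ∀ {n} (f : Fin n → Fin n → Bool) → (∀ i j → f i j ≡ f j i) →
             ∀ a b i j → toggle f a b i j ≡ toggle f a b j i
toggle-sym f f-sym a b i j with pair? Fin._≟_ a b i j
... | yes p = trans (toggle-pair f a b p) (trans (cong not (f-sym i j)) (sym (toggle-pair f a b (Pair-sym p))))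
... | no ¬p = trans (toggle-other f a b ¬p) (trans (f-sym i j) (sym (toggle-other f a b (¬p ∘ Pair-sym))))

not≡true⇔⇒≡true⇔¬ : ∀ {b} {Q : Set} → (not b ≡ true) ⇔ Q → (b ≡ true) ⇔ (¬ Q)
not≡true⇔⇒≡true⇔¬ {true}  e = mk⇔ (λ _ q → contradiction (Equivalence.from e q) λ ()) (λ _ → refl)
not≡true⇔⇒≡true⇔¬ {false} e = mk⇔ (λ ()) (λ ¬q → contradiction (Equivalence.to e refl) ¬q)

-- Here Q is recovered from its double negation, hence the decision procedure.
≡true⇔¬⇒not≡true⇔ : ∀ {b} {Q : Set} → Dec Q → (b ≡ true) ⇔ (¬ Q) → (not b ≡ true) ⇔ Q
≡true⇔¬⇒not≡true⇔ {true}  q? e = mk⇔ (λ ()) (λ q → contradiction q (Equivalence.to e refl))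
≡true⇔¬⇒not≡true⇔ {false} q? e =
  mk⇔ (λ _ → decidable-stable q? (λ ¬q → contradiction (Equivalence.from e ¬q) λ ())) (λ _ → refl)

module _ {V : Set} (G : V → V → Set) (Π : LocFinPerturbation V) where

  perturb-unperturbed : ∀ {x y} → ¬ P Π x y → G x y ⇔ perturb G Π x y
  perturb-unperturbed ¬p = mk⇔ (λ g → inj₁ (g , ¬p)) [ proj₁ , (λ (_ , p) → contradiction p ¬p) ]′

  perturb-perturbed : ∀ {x y} → P Π x y → (¬ G x y) ⇔ perturb G Π x y
  perturb-perturbed p = mk⇔ (λ ¬g → inj₂ (¬g , p)) [ (λ (_ , ¬p) → contradiction p ¬p) , proj₁ ]′

  module _ {n} (f : Fin n → Fin n → Bool) {a b i j : Fin n} {x y : V}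
           (perturbed : Pair a b i j → P Π x y) (unperturbed : ¬ Pair a b i j → ¬ P Π x y) where

    -- Toggling and perturbing both negate adjacency on the pair {a, b}, and both leave it alone
    -- elsewhere.
    toggled⇒perturbed : (toggle f a b i j ≡ true) ⇔ G x y → (f i j ≡ true) ⇔ perturb G Π x y
    toggled⇒perturbed e with pair? Fin._≟_ a b i j
    ... | yes ij = perturb-perturbed (perturbed ij) ⇔-∘
                   not≡true⇔⇒≡true⇔¬ (subst (λ c → (c ≡ true) ⇔ G x y) (toggle-pair f a b ij) e)
    ... | no ¬ij = perturb-unperturbed (unperturbed ¬ij) ⇔-∘
                   subst (λ c → (c ≡ true) ⇔ G x y) (toggle-other f a b ¬ij) e

    perturbed⇒toggled : Dec (G x y) → (f i j ≡ true) ⇔ perturb G Π x y → (toggle f a b i j ≡ true) ⇔ G x y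
    perturbed⇒toggled G? e with pair? Fin._≟_ a b i j
    ... | yes ij = subst (λ c → (c ≡ true) ⇔ G x y) (sym (toggle-pair f a b ij))
                     (≡true⇔¬⇒not≡true⇔ G? (⇔-sym (perturb-perturbed (perturbed ij)) ⇔-∘ e))
    ... | no ¬ij = subst (λ c → (c ≡ true) ⇔ G x y) (sym (toggle-other f a b ¬ij))
                     (⇔-sym (perturb-unperturbed (unperturbed ¬ij)) ⇔-∘ e)

singlePair : ∀ {V : Set} (u v : V) → u ≢ v → LocFinPerturbation V
singlePair u v u≢v = record
  { P          = Pair u v
  ; P-sym      = λ _ _ → Pair-sym
  ; P-distinct = λ { _ _ (inj₁ (refl , refl)) → u≢v ; _ _ (inj₂ (refl , refl)) → u≢v ∘ sym }
  ; nonempty   = u , v , inj₁ (refl , refl)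
  ; locFinite  = λ _ → u ∷ v ∷ [] , λ { _ (inj₁ (_ , refl)) → there (here refl) ; _ (inj₂ (_ , refl)) → here refl }
  }

-- The saturation criterion for dense pairs of orders

module _ {V : Set} (U : DenseBiorder V) where

  open DenseBiorder U
  open UnboundedOrder O₁ using () renaming
    (compare to compare₁; ≺-irrefl to ≺₁-irrefl; ≺-asym to ≺₁-asym; _≺?_ to _≺₁?_; _≟_ to _≟ᵥ_)
  open UnboundedOrder O₂ using () renaming
    (compare to compare₂; ≺-irrefl to ≺₂-irrefl; ≺-asym to ≺₂-asym; _≺?_ to _≺₂?_)

  Adj : V → V → Set
  Adj = Concordant _≺₁_ _≺₂_

  adj? : ∀ u v → Dec (Adj u v)
  adj? u v = (u ≺₁? v ×-dec u ≺₂? v) ⊎-dec (v ≺₁? u ×-dec v ≺₂? u)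

  adjacent-pair : ∃[ u ] ∃[ v ] u ≢ v × Adj u v
  adjacent-pair with p ← UnboundedOrder.origin O₁
    with q , p≺₁q , _ , p≺₂q , _ ← dense (proj₂ (UnboundedOrder.above O₁ p)) (proj₂ (UnboundedOrder.above O₂ p))
    = p , q , (λ { refl → ≺₁-irrefl refl p≺₁q }) , inj₁ (p≺₁q , p≺₂q)

  -- Joint density yields a point above `p` in the first order and below it in the second.
  nonadjacent-pair : ∃[ u ] ∃[ v ] u ≢ v × ¬ Adj u v
  nonadjacent-pair with p ← UnboundedOrder.origin O₁
    with q , p≺₁q , _ , _ , q≺₂p ← dense (proj₂ (UnboundedOrder.above O₁ p)) (proj₂ (UnboundedOrder.below O₂ p))
    = p , q , (λ { refl → ≺₁-irrefl refl p≺₁q }) ,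
      [ (λ (_ , p≺₂q) → ≺₂-asym p≺₂q q≺₂p) , (λ (q≺₁p , _) → ≺₁-asym p≺₁q q≺₁p) ]′

  module _ {n} (π ρ : Permutation n n) where

    -- Preserving ranks suffices for the converse too: ranks are total and the orders asymmetric.
    ranks-reflect-Adj : ∀ {i j x y} → i ≢ j →
      (Rank π i j → x ≺₁ y) × (Rank ρ i j → x ≺₂ y) → (Rank π j i → y ≺₁ x) × (Rank ρ j i → y ≺₂ x) →
      Concordant (Rank π) (Rank ρ) i j ⇔ Adj x y
    ranks-reflect-Adj {i} {j} i≢j (p , q) (p′ , q′) = mk⇔ (Sum.map (Product.map p q) (Product.map p′ q′))
      (Sum.map (λ (x≺y , x≺′y) → reflect π i≢j (≺₁-asym x≺y ∘ p′) , reflect ρ i≢j (≺₂-asym x≺′y ∘ q′))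
               (λ (y≺x , y≺′x) → reflect π (i≢j ∘ sym) (≺₁-asym y≺x ∘ p) , reflect ρ (i≢j ∘ sym) (≺₂-asym y≺′x ∘ q)))
      where
      reflect : ∀ (τ : Permutation n n) {i j} → i ≢ j → ¬ Rank τ j i → Rank τ i j
      reflect τ i≢j j≮i = [ (λ i<j → i<j) , (λ j<i → contradiction j<i j≮i) ]′ (Rank-total τ i≢j)

    -- Once the first orders are aligned, adjacency says whether the second agrees with the first;
    -- so equal adjacency forces the second orders to match.
    second-order-agrees : ∀ {a b u v} → u ≢ v → Rank π a b → u ≺₁ v →
      Concordant (Rank π) (Rank ρ) a b ⇔ Adj u v → (Rank ρ a b → u ≺₂ v) × (Rank ρ b a → v ≺₂ u)
    second-order-agrees {a} {b} {u} {v} u≢v πa<πb u≺₁v e = forward , backward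
      where
      forward : Rank ρ a b → u ≺₂ v
      forward ρa<ρb with Equivalence.to e (inj₁ (πa<πb , ρa<ρb))
      ... | inj₁ (_ , u≺₂v) = u≺₂v
      ... | inj₂ (v≺₁u , _) = contradiction v≺₁u (≺₁-asym u≺₁v)
      backward : Rank ρ b a → v ≺₂ u
      backward ρb<ρa with compare₂ u v
      ... | tri≈ _ u≡v _  = contradiction u≡v u≢v
      ... | tri> _ _ v≺₂u = v≺₂u
      ... | tri< u≺₂v _ _ with Equivalence.from e (inj₁ (u≺₁v , u≺₂v))
      ...   | inj₁ (_ , ρa<ρb) = contradiction ρb<ρa (Fin.<-asym ρa<ρb)
      ...   | inj₂ (πb<πa , _) = contradiction πb<πa (Fin.<-asym πa<πb)

    module _ (g : Fin n → V)
             (ordered : ∀ {i j} → i ≢ j → (Rank π i j → g i ≺₁ g j) × (Rank ρ i j → g i ≺₂ g j)) where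

      ordered-injective : ∀ i j → g i ≡ g j → i ≡ j
      ordered-injective i j gi≡gj with i Fin.≟ j
      ... | yes i≡j = i≡j
      ... | no i≢j with Rank-total π i≢j
      ...   | inj₁ i<j = contradiction (proj₁ (ordered i≢j) i<j) (≺₁-irrefl gi≡gj)
      ...   | inj₂ j<i = contradiction (proj₁ (ordered (i≢j ∘ sym)) j<i) (≺₁-irrefl (sym gi≡gj))

      ordered-Adj : ∀ {i j} → i ≢ j → Concordant (Rank π) (Rank ρ) i j ⇔ Adj (g i) (g j)
      ordered-Adj i≢j = ranks-reflect-Adj i≢j (ordered i≢j) (ordered (i≢j ∘ sym))

  -- The same embedding with an empty relation to avoid and nothing placed in advance.
  permutationGraph⇒induced : ∀ H → IsPermutationGraph (n H) (adj H) → ContainsInduced Adj H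
  permutationGraph⇒induced H perm =
    let π , ρ , conc = permutationGraph⇒ranks (adj H) (FinGraph.sym H) perm
        g , _ , placed = embed U {P = λ _ _ → ⊥} (λ _ _ p → p) (λ _ → [] , λ _ ()) π ρ (λ _ _ → ⊥)
                           (λ _ → UnboundedOrder.origin O₁) [] (λ ())
    in g , ordered-injective π ρ g (proj₁ ∘ placed) , λ i j i≢j → ordered-Adj π ρ g (proj₁ ∘ placed) i≢j ⇔-∘ conc i≢j

  module _ (H : FinGraph) (Π : LocFinPerturbation V) {a b : Fin (n H)} where

    private
      T : Fin (n H) → Fin (n H) → Bool
      T = toggle (adj H) a b

      T-sym : ∀ i j → T i j ≡ T j i
      T-sym = toggle-sym (adj H) (FinGraph.sym H) a b

    -- The perturbed pair `s`, `t` receives `x`, `y`, and every other vertex avoids the perturbed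
    -- partners of those placed before. So {x, y} is the only perturbed pair of the copy, and
    -- perturbing it undoes the toggle.
    induced-copy-aligned : ∀ (π ρ : Permutation (n H) (n H)) →
      (∀ {i j} → i ≢ j → (T i j ≡ true) ⇔ Concordant (Rank π) (Rank ρ) i j) →
      ∀ {x y s t} → x ≢ y → Pair a b x y → P Π s t → Rank π x y → s ≺₁ t → (T x y ≡ true) ⇔ Adj s t →
      ContainsInduced (perturb Adj Π) H
    induced-copy-aligned π ρ conc {x} {y} {s} {t} x≢y xy Pst πx<πy s≺₁t edge =
      finish (embed U (P-sym Π) (locFinite Π) π ρ (Pair a b) start (x ∷ y ∷ []) good)
      where
      start : Fin (n H) → V
      -- Away from `x` and `y` the value `t` is a placeholder, overwritten by the extension.
      start = updateAt (λ _ → t) x (λ _ → s)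
      start-x : start x ≡ s
      start-x = updateAt-updates x (λ _ → t)
      start-y : start y ≡ t
      start-y = updateAt-minimal y x (λ _ → t) (x≢y ∘ sym)
      s≢t : s ≢ t
      s≢t = P-distinct Π s t Pst
      second : (Rank ρ x y → s ≺₂ t) × (Rank ρ y x → t ≺₂ s)
      second = second-order-agrees π ρ s≢t πx<πy s≺₁t (edge ⇔-∘ ⇔-sym (conc x≢y))
      Good : Fin (n H) → Fin (n H) → V → V → Set
      Good = Placed U (P-sym Π) (locFinite Π) π ρ (Pair a b)
      good : Compatible Good start (x ∷ y ∷ [])
      good = Compatible-pair Good start
        (subst₂ (Good x y) (sym start-x) (sym start-y)
          (((λ _ → s≺₁t) , proj₁ second) , λ ¬xy → contradiction xy ¬xy))
        (subst₂ (Good y x) (sym start-y) (sym start-x)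
          (((λ πy<πx → contradiction πy<πx (Fin.<-asym πx<πy)) , proj₂ second) ,
           λ ¬yx → contradiction (Pair-sym xy) ¬yx))
      finish : ∃[ g ] (∀ {i} → i ∈ x ∷ y ∷ [] → g i ≡ start i) × (∀ {i j} → i ≢ j → Good i j (g i) (g j)) →
               ContainsInduced (perturb Adj Π) H
      finish (g , agree , placed) = g , ordered-injective π ρ g (proj₁ ∘ placed) , λ i j i≢j →
        toggled⇒perturbed Adj Π (adj H)
          (λ ij → Pair-respects (P-sym Π) Pgxgy (Pair-map g (Pair-unique xy ij)))
          (proj₂ (placed i≢j)) (ordered-Adj π ρ g (proj₁ ∘ placed) i≢j ⇔-∘ conc i≢j)
        where
        Pgxgy : P Π (g x) (g y)
        Pgxgy = subst₂ (P Π) (sym (trans (agree (here refl)) start-x))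
                             (sym (trans (agree (there (here refl))) start-y)) Pst

    -- Reversing either pair where necessary makes both increase in their first orders, as the
    -- aligned case demands.
    induced-copy : IsPermutationGraph (n H) T → a ≢ b → ∀ {u v} → P Π u v → (T a b ≡ true) ⇔ Adj u v →
                   ContainsInduced (perturb Adj Π) H
    induced-copy perm a≢b {u} {v} Puv edge =
      let π , ρ , conc = permutationGraph⇒ranks T T-sym perm
      in align π ρ conc (Rank-total π a≢b) (compare₁ u v)
      where
      module _ (π ρ : Permutation (n H) (n H))
               (conc : ∀ {i j} → i ≢ j → (T i j ≡ true) ⇔ Concordant (Rank π) (Rank ρ) i j) where
        align : Rank π a b ⊎ Rank π b a → Tri (u ≺₁ v) (u ≡ v) (v ≺₁ u) → ContainsInduced (perturb Adj Π) H
        align _ (tri≈ _ u≡v _) = contradiction u≡v (P-distinct Π u v Puv)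
        align (inj₁ πa<πb) (tri< u≺v _ _) =
          induced-copy-aligned π ρ conc a≢b (inj₁ (refl , refl)) Puv πa<πb u≺v edge
        align (inj₁ πa<πb) (tri> _ _ v≺u) =
          induced-copy-aligned π ρ conc a≢b (inj₁ (refl , refl)) (P-sym Π u v Puv) πa<πb v≺u
            (mk⇔ Sum.swap Sum.swap ⇔-∘ edge)
        align (inj₂ πb<πa) (tri< u≺v _ _) =
          induced-copy-aligned π ρ conc (a≢b ∘ sym) (inj₂ (refl , refl)) Puv πb<πa u≺v
            (subst (λ e → (e ≡ true) ⇔ Adj u v) (T-sym a b) edge)
        align (inj₂ πb<πa) (tri> _ _ v≺u) =
          induced-copy-aligned π ρ conc (a≢b ∘ sym) (inj₂ (refl , refl)) (P-sym Π u v Puv) πb<πa v≺u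
            (mk⇔ Sum.swap Sum.swap ⇔-∘ subst (λ e → (e ≡ true) ⇔ Adj u v) (T-sym a b) edge)

  -- A copy that misses `u` or `v` contains no perturbed pair and would be a copy in the unperturbed
  -- graph. So both are hit, and toggling their preimages gives a graph induced in the unperturbed
  -- one.
  single-perturbation-copy : ∀ H {u v} (u≢v : u ≢ v) → Free Adj H →
    ContainsInduced (perturb Adj (singlePair u v u≢v)) H →
    ∃[ a ] ∃[ b ] a ≢ b × (adj H a b ≡ true) ⇔ (¬ Adj u v) × IsPermutationGraph (n H) (toggle (adj H) a b)
  single-perturbation-copy H {u} {v} u≢v free (f , f-inj , edge)
    with Fin.any? (λ i → f i ≟ᵥ u) | Fin.any? (λ i → f i ≟ᵥ v)
  ... | no u∉f | _ = ⊥-elim (free (f , f-inj , λ i j i≢j →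
          ⇔-sym (perturb-unperturbed Adj (singlePair u v u≢v)
            [ (λ (fi≡u , _) → u∉f (i , fi≡u)) , (λ (_ , fj≡u) → u∉f (j , fj≡u)) ]′) ⇔-∘ edge i j i≢j))
  ... | _ | no v∉f = ⊥-elim (free (f , f-inj , λ i j i≢j →
          ⇔-sym (perturb-unperturbed Adj (singlePair u v u≢v)
            [ (λ (_ , fj≡v) → v∉f (j , fj≡v)) , (λ (fi≡v , _) → v∉f (i , fi≡v)) ]′) ⇔-∘ edge i j i≢j))
  ... | yes (a , refl) | yes (b , refl) =
      a , b , a≢b , ⇔-sym (perturb-perturbed Adj Π (inj₁ (refl , refl))) ⇔-∘ edge a b a≢b ,
      induced⇒permutationGraph U (toggle (adj H) a b) f (λ {i} {j} → f-inj i j) λ {i} {j} i≢j →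
        perturbed⇒toggled Adj Π (adj H) (Pair-map f)
          (λ ¬ij → ¬ij ∘ Sum.map (Product.map (f-inj i a) (f-inj j b)) (Product.map (f-inj i b) (f-inj j a)))
          (adj? (f i) (f j)) (edge i j i≢j)
    where
    Π = singlePair (f a) (f b) u≢v
    a≢b : a ≢ b
    a≢b refl = u≢v refl

  stronglyInducedSaturated⇔ : ∀ H → StronglyInducedSaturated Adj H ⇔
    ((¬ IsPermutationGraph (n H) (adj H))
     × (∃[ a ] ∃[ b ] (adj H a b ≡ true × IsPermutationGraph (n H) (toggle (adj H) a b)))
     × (∃[ a ] ∃[ b ] (a ≢ b × adj H a b ≡ false × IsPermutationGraph (n H) (toggle (adj H) a b))))
  stronglyInducedSaturated⇔ H = mk⇔ necessary sufficient
    where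
    open Equivalence
    necessary : StronglyInducedSaturated Adj H → _
    necessary (free , saturated) = free ∘ permutationGraph⇒induced H , edge , nonedge
      where
      edge : ∃[ a ] ∃[ b ] (adj H a b ≡ true × IsPermutationGraph (n H) (toggle (adj H) a b))
      edge =
        -- A perturbed non-edge becomes an edge, so its preimage is an edge of `H`; below, a
        -- perturbed edge yields a non-edge.
        let u , v , u≢v , ¬uv = nonadjacent-pair
            a , b , _ , e , perm = single-perturbation-copy H u≢v free (saturated (singlePair u v u≢v))
        in a , b , from e ¬uv , perm
      nonedge : ∃[ a ] ∃[ b ] (a ≢ b × adj H a b ≡ false × IsPermutationGraph (n H) (toggle (adj H) a b))
      nonedge =
        let u , v , u≢v , uv = adjacent-pair
            a , b , a≢b , e , perm = single-perturbation-copy H u≢v free (saturated (singlePair u v u≢v))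
        in a , b , a≢b , ¬-not (λ ab → to e ab uv) , perm
    sufficient : _ → StronglyInducedSaturated Adj H
    sufficient (¬perm , (a , b , ab , perm) , (a′ , b′ , a′≢b′ , a′b′ , perm′)) =
      (λ (f , f-inj , edge) → ¬perm (induced⇒permutationGraph U (adj H) f (λ {i} {j} → f-inj i j)
        (λ {i} {j} → edge i j))) , copy
      where
      copy : ∀ Π → ContainsInduced (perturb Adj Π) H
      copy Π with u , v , Puv ← nonempty Π | adj? u v
      -- On a perturbed edge the non-edge of `H` from condition (3) is placed, and on a perturbed
      -- non-edge the edge from condition (2); the toggled pair then has the adjacency of `u`, `v`
      -- before perturbation.
      ... | yes uv = induced-copy H Π perm′ a′≢b′ Puv (mk⇔ (λ _ → uv) (λ _ →
              trans (toggle-pair (adj H) a′ b′ (inj₁ (refl , refl))) (cong not a′b′)))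
      ... | no ¬uv = induced-copy H Π perm a≢b Puv (mk⇔
              (λ Tab → contradiction (trans (sym Tab)
                (trans (toggle-pair (adj H) a b (inj₁ (refl , refl))) (cong not ab))) λ ())
              (λ uv → contradiction uv ¬uv))
        where
        a≢b : a ≢ b
        a≢b refl = contradiction (trans (sym ab) (irrefl H a)) λ ()

theorem7p2 : (H : FinGraph) →
    StronglyInducedSaturated UAdj H ⇔
    ((¬ IsPermutationGraph (n H) (adj H))
    × (∃[ a ] ∃[ b ] (adj H a b ≡ true × IsPermutationGraph (n H) (toggle (adj H) a b)))
    × (∃[ a ] ∃[ b ] (a ≢ b × adj H a b ≡ false × IsPermutationGraph (n H) (toggle (adj H) a b))))
theorem7p2 = stronglyInducedSaturated⇔ upRight
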